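{- Let $q$ be a prime power, $k\ge1$, and let $U$ be a $k\times m$ matrix over $\mathbb{F}_q$ whose columns form a maximal set of nonzero vectors of $\mathbb{F}_q^k$ no one of which is a scalar multiple of another. Then, up to isomorphism, $\mathfrak{g}_k(\mathbb{F}_q)$ is exactly the set of looped graphs $\Gamma(U^tBU)$ for $B\in\mathcal{B}$, where: (1) if $k$ is odd, $\mathcal{B}=\{I_k\}$; (2) if $k$ is even and $q$ is even, $\mathcal{B}=\{I_k,\operatorname{diag}(H,H,\dots,H)\}$ with $k/2$ copies of $H=\begin{bmatrix}0&1\\1&0\end{bmatrix}$; (3) if $k$ is even and $q$ is odd, $\mathcal{B}=\{I_k,\operatorname{diag}(I_{k-1},\nu)\}$ where $\nu$ is any nonsquare in $\mathbb{F}_q$.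
   Context: For a symmetric $n\times n$ matrix $A$, the looped graph corresponding to $A$, $\Gamma(A)$, has vertex set $\{1,\dots,n\}$, an edge $ij$ ($i\neq j$) iff $a_{ij}\neq0$, and a loop at $i$ iff $a_{ii}\ne 0$. Definition of $\mathfrak{g}_k(\mathbb{F}_q)$: let $x_1,\dots,x_m$ be representatives of the classes of nonzero vectors of $\mathbb{F}_q^k$ under the relation $x\sim cx$ ($c\in\mathbb{F}_q$, $c\neq0$), and let $U=[x_1\ \cdots\ x_m]$; $\mathfrak{g}_k(\mathbb{F}_q)$ is the set of isomorphism classes of looped graphs $\Gamma(U^tBU)$ as $B$ ranges over the invertible symmetric $k\times k$ matrices over $\mathbb{F}_q$. -}

module Defs where

open import Algebra.Bundles using (CommutativeRing)
open import Data.Bool.Base using (if_then_else_)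
open import Data.Fin.Base using (Fin; fromℕ; remQuot)
open import Data.Fin.Patterns using (0F; 1F)
open import Data.Fin.Properties using (_≟_)
open import Data.List.Base using (List)
open import Data.List.Membership.Propositional using () renaming (_∈_ to _∈ˡ_)
open import Data.Nat.Base using (ℕ; suc; _*_; _^_; NonZero)
open import Data.Nat.Divisibility using (_∣_; divides)
open import Data.Nat.Primality using (Prime)
open import Data.Product.Base using (Σ-syntax; ∃-syntax; ∃₂; _×_; _,_)
open import Data.Vec.Functional using (Vector; replicate; insertAt)
open import Function.Bundles using (Inverse; _↔_; _⇔_)
open import Level using (Level; _⊔_) renaming (suc to lsuc)
open import Relation.Binary.PropositionalEquality using (_≡_; _≢_; refl; sym; setoid)
open import Relation.Nullary using (¬_; does; yes; no; contradiction)
open import Relation.Unary using (Pred)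

private
  variable
    k l m n r : ℕ

IsPrimePower : ℕ → Set
IsPrimePower q = ∃₂ λ p e → Prime p × NonZero e × q ≡ p ^ e

record FiniteField (q : ℕ) (c ℓ : Level) : Set (lsuc (c ⊔ ℓ)) where
  field
    commutativeRing : CommutativeRing c ℓ
  open CommutativeRing commutativeRing using (Carrier; _≈_; 0#; 1#)
    renaming (_*_ to _·_; setoid to ≈-setoid)
  field
    1≉0     : ¬ (1# ≈ 0#)
    inverse : ∀ x → ¬ (x ≈ 0#) → ∃[ y ] (x · y ≈ 1#)
    finite  : Inverse ≈-setoid (setoid (Fin q))

-- Adj i j for i ≢ j says that ij is an edge; Adj i i says that i has a loop.
record LoopedGraph (ℓ : Level) : Set (lsuc ℓ) where
  field
    order   : ℕ
    Adj     : Fin order → Fin order → Set ℓ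
    Adj-sym : ∀ {i j} → Adj i j → Adj j i

infix 4 _≅_

_≅_ : ∀ {ℓ} → LoopedGraph ℓ → LoopedGraph ℓ → Set ℓ
G ≅ H = Σ[ σ ∈ Fin (order G) ↔ Fin (order H) ]
          (∀ i j → Adj G i j ⇔ Adj H (Inverse.to σ i) (Inverse.to σ j))
  where open LoopedGraph

module Over {q : ℕ} {c ℓ : Level} (F : FiniteField q c ℓ) where

  open CommutativeRing (FiniteField.commutativeRing F) public
    using (Carrier; _≈_; 0#; 1#; semiring; *-comm; *-assoc; *-congˡ; *-congʳ)
    renaming (_*_ to _·_; refl to ≈-refl; sym to ≈-sym; trans to ≈-trans; setoid to ≈-setoid)
  open import Algebra.Properties.Semiring.Sum semiring public
    using (sum; sum-syntax; sum-cong-≋; ∑-comm; *-distribˡ-sum; *-distribʳ-sum)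

  IsSquare : Carrier → Set (c ⊔ ℓ)
  IsSquare a = ∃[ x ] (x · x ≈ a)

  Matrix : ℕ → ℕ → Set c
  Matrix m n = Fin m → Fin n → Carrier

  infix  4 _≈ᴹ_
  infixl 7 _⊗_
  infix  8 _ᵗ

  _≈ᴹ_ : Matrix m n → Matrix m n → Set ℓ
  A ≈ᴹ B = ∀ i j → A i j ≈ B i j

  _⊗_ : Matrix m n → Matrix n l → Matrix m l
  (A ⊗ B) i j = ∑[ t < _ ] (A i t · B t j)

  _ᵗ : Matrix m n → Matrix n m
  (A ᵗ) i j = A j i

  diag : Vector Carrier n → Matrix n n
  diag d i j = if does (i ≟ j) then d i else 0#

  𝐈 : (n : ℕ) → Matrix n n
  𝐈 n = diag (replicate n 1#)

  blockEntry : Vector (Matrix r r) n → Fin n × Fin r → Fin n × Fin r → Carrier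
  blockEntry Bs (s , a) (t , b) = if does (s ≟ t) then Bs s a b else 0#

  blockDiag : Vector (Matrix r r) n → Matrix (n * r) (n * r)
  blockDiag {r} {n} Bs i j = blockEntry Bs (remQuot {n} r i) (remQuot {n} r j)

  Invertible : Matrix n n → Set (c ⊔ ℓ)
  Invertible {n} A = ∃[ C ] (A ⊗ C ≈ᴹ 𝐈 n × C ⊗ A ≈ᴹ 𝐈 n)

  Symmetric : Matrix n n → Set ℓ
  Symmetric A = A ᵗ ≈ᴹ A

  record SymMatrix (n : ℕ) : Set (c ⊔ ℓ) where
    constructor _because_
    field
      matrix    : Matrix n n
      symmetric : Symmetric matrix
  open SymMatrix public

  diag-symmetric : (d : Vector Carrier n) → Symmetric (diag d)
  diag-symmetric d i j with i ≟ j | j ≟ i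
  ... | yes refl | yes _    = ≈-refl
  ... | yes i≡j  | no  j≢i  = contradiction (sym i≡j) j≢i
  ... | no  i≢j  | yes j≡i  = contradiction (sym j≡i) i≢j
  ... | no  _    | no  _    = ≈-refl

  blockEntry-symmetric : (Bs : Vector (Matrix r r) n) → (∀ t → Symmetric (Bs t)) →
                         ∀ x y → blockEntry Bs y x ≈ blockEntry Bs x y
  blockEntry-symmetric Bs Bs-sym (s , a) (t , b) with s ≟ t | t ≟ s
  ... | yes refl | yes _    = Bs-sym s a b
  ... | yes s≡t  | no  t≢s  = contradiction (sym s≡t) t≢s
  ... | no  s≢t  | yes t≡s  = contradiction (sym t≡s) s≢t
  ... | no  _    | no  _    = ≈-refl

  blockDiag-symmetric : (Bs : Vector (Matrix r r) n) → (∀ t → Symmetric (Bs t)) →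
                        Symmetric (blockDiag Bs)
  blockDiag-symmetric {r} {n} Bs Bs-sym i j =
    blockEntry-symmetric Bs Bs-sym (remQuot {n} r i) (remQuot {n} r j)

  congruence-symmetric : (U : Matrix k m) {B : Matrix k k} →
                         Symmetric B → Symmetric (U ᵗ ⊗ B ⊗ U)
  congruence-symmetric {k} U {B} B-sym i j = begin
    ∑[ s < k ] ((∑[ t < k ] (U t j · B t s)) · U s i)
      ≈⟨ sum-cong-≋ (λ s → *-distribʳ-sum (U s i) (λ t → U t j · B t s)) ⟩
    ∑[ s < k ] (∑[ t < k ] (U t j · B t s · U s i))
      ≈⟨ ∑-comm (λ s t → U t j · B t s · U s i) ⟩
    ∑[ t < k ] (∑[ s < k ] (U t j · B t s · U s i))
      ≈⟨ sum-cong-≋ (λ t → sum-cong-≋ (λ s → swap s t)) ⟩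
    ∑[ t < k ] (∑[ s < k ] (U s i · B s t · U t j))
      ≈⟨ sum-cong-≋ (λ t → *-distribʳ-sum (U t j) (λ s → U s i · B s t)) ⟨
    ∑[ t < k ] ((∑[ s < k ] (U s i · B s t)) · U t j) ∎
    where
    open import Relation.Binary.Reasoning.Setoid ≈-setoid
    swap : ∀ s t → U t j · B t s · U s i ≈ U s i · B s t · U t j
    swap s t = begin
      U t j · B t s · U s i    ≈⟨ *-comm _ _ ⟩
      U s i · (U t j · B t s)  ≈⟨ *-congˡ (*-comm _ _) ⟩
      U s i · (B t s · U t j)  ≈⟨ *-assoc _ _ _ ⟨
      U s i · B t s · U t j    ≈⟨ *-congʳ (*-congˡ (B-sym s t)) ⟩
      U s i · B s t · U t j    ∎

  congruence : Matrix k m → SymMatrix k → SymMatrix m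
  congruence U B = (U ᵗ ⊗ matrix B ⊗ U) because congruence-symmetric U (symmetric B)

  Γ : SymMatrix n → LoopedGraph ℓ
  Γ {n} A = record
    { order   = n
    ; Adj     = λ i j → ¬ (matrix A i j ≈ 0#)
    ; Adj-sym = λ {i} {j} aᵢⱼ≉0 aⱼᵢ≈0 → aᵢⱼ≉0 (≈-trans (symmetric A j i) aⱼᵢ≈0)
    }

  infix 4 _≈ⱽ_ _∼_

  _≈ⱽ_ : Vector Carrier k → Vector Carrier k → Set ℓ
  x ≈ⱽ y = ∀ i → x i ≈ y i

  _•_ : Carrier → Vector Carrier k → Vector Carrier k
  (a • x) i = a · x i

  NonzeroVector : Vector Carrier k → Set ℓ
  NonzeroVector x = ¬ (∀ i → x i ≈ 0#)

  _∼_ : Vector Carrier k → Vector Carrier k → Set (c ⊔ ℓ)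
  x ∼ y = ∃[ a ] (¬ (a ≈ 0#) × y ≈ⱽ a • x)

  column : Matrix k m → Fin m → Vector Carrier k
  column = _ᵗ

  record IsRepresentatives (X : Matrix k m) : Set (c ⊔ ℓ) where
    field
      nonzero    : ∀ j → NonzeroVector (column X j)
      distinct   : ∀ i j → column X i ∼ column X j → i ≡ j
      exhaustive : ∀ v → NonzeroVector v → ∃[ j ] (column X j ∼ v)

  -- The set 𝔤ₖ(F), as an isomorphism-closed class of looped graphs, computed
  -- from the matrix X of chosen representatives.
  𝔤 : Matrix k m → Pred (LoopedGraph ℓ) (c ⊔ ℓ)
  𝔤 {k} X G = ∃[ B ] (Invertible (matrix B) × G ≅ Γ (congruence X B))

  record NonzeroNonproportional (U : Matrix k m) : Set (c ⊔ ℓ) where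
    field
      nonzero         : ∀ j → NonzeroVector (column U j)
      nonproportional : ∀ i j → i ≢ j → ¬ (∃[ a ] (column U i ≈ⱽ a • column U j))

  infix 4 _⊆ᶜ_

  _⊆ᶜ_ : Matrix k m → Matrix k n → Set ℓ
  U ⊆ᶜ V = ∀ i → ∃[ j ] (column U i ≈ⱽ column V j)

  record IsMaximalNonproportional (U : Matrix k m) : Set (c ⊔ ℓ) where
    field
      nonzeroNonproportional : NonzeroNonproportional U
      maximal                : ∀ {n} (V : Matrix k n) → NonzeroNonproportional V →
                               U ⊆ᶜ V → V ⊆ᶜ U

  GraphsFrom : Matrix k m → List (SymMatrix k) → Pred (LoopedGraph ℓ) (c ⊔ ℓ)
  GraphsFrom U 𝓑 G = ∃[ B ] (B ∈ˡ 𝓑 × G ≅ Γ (congruence U B))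

  identity : (k : ℕ) → SymMatrix k
  identity k = 𝐈 k because diag-symmetric _

  H : Matrix 2 2
  H 0F 0F = 0#
  H 0F 1F = 1#
  H 1F 0F = 1#
  H 1F 1F = 0#

  H-symmetric : Symmetric H
  H-symmetric 0F 0F = ≈-refl
  H-symmetric 0F 1F = ≈-refl
  H-symmetric 1F 0F = ≈-refl
  H-symmetric 1F 1F = ≈-refl

  diagH : 2 ∣ k → SymMatrix k
  diagH (divides h refl) =
    blockDiag (replicate h H) because blockDiag-symmetric (replicate h H) (λ _ → H-symmetric)

  -- diag(I_{k-1}, ν)
  diagI-ν : (k : ℕ) .{{_ : NonZero k}} → Carrier → SymMatrix k
  diagI-ν (suc n) ν = diag (insertAt (replicate n 1#) (fromℕ n) ν) because diag-symmetric _

{-# OPTIONS --safe #-}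

-- Two columns of U are adjacent iff the bilinear form of B does not vanish on the lines they span,
-- so an isometry up to scaling between two forms permutes the lines and induces an isomorphism of
-- graphs.  It therefore suffices to classify nondegenerate symmetric bilinear forms over a finite
-- field up to similarity, by splitting off anisotropic lines and, in characteristic 2, hyperbolic
-- planes.  In characteristic 2 every scalar is a square and ⟨1⟩ ⊥ ℍ is isometric to ⟨1, 1, 1⟩, which
-- leaves sums of ⟨1⟩ and sums of ℍ.  In odd characteristic every form of rank at least 2 represents
-- 1, which leaves the discriminant modulo squares; in odd rank this is removed by scaling, since
-- ⟨c, c⟩ is isometric to ⟨1, 1⟩.

module Submission where

open import Defs
open import Algebra.Bundles using (CommutativeRing)
open import Data.Fin.Base using (Fin; fromℕ; punchIn; punchOut; suc; toℕ; zero)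
open import Data.Fin.Patterns using (0F; 1F)
open import Data.Fin.Permutation using (Permutation; permutation)
open import Data.Fin.Properties
  using (_≟_; all?; any?; injective⇒≤; pigeonhole; punchOut-injective; toℕ-injective)
open import Data.List.Base using (List)
open import Data.List.Membership.Propositional using (_∈_)
open import Data.List.Relation.Unary.Any using (here; there)
open import Data.Nat.Base as ℕ using (NonZero; _^_; suc; zero; ℕ)
open import Data.Nat.Divisibility using (_∣_; divides; ∣1⇒≡1)
open import Data.Nat.Primality using (euclidsLemma; prime?; prime⇒irreducible)
import Data.Nat.Properties as ℕ
open import Data.Product.Base using (_,_; _×_; proj₁; proj₂; Σ; Σ-syntax; ∃-syntax; ∃₂)
open import Data.Sum.Base as Sum using ([_,_]′; _⊎_; inj₁; inj₂)
open import Data.Vec.Functional using (Vector; insertAt; removeAt; replicate; tail; zipWith)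
open import Data.Vec.Functional.Properties
  using (insertAt-lookup; insertAt-punchIn; insertAt-removeAt)
open import Function.Base using (_∘_)
open import Function.Bundles using (Equivalence; Inverse; _↔_; _⇔_; mk↔ₛ′; mk⇔)
open import Function.Definitions using (Injective)
open import Level using (Level; _⊔_)
open import Relation.Binary.PropositionalEquality as ≡ using (_≡_; refl)
open import Relation.Nullary using (Dec; _×-dec_; contradiction; no; yes; ¬?; ¬_)
open import Relation.Nullary.Decidable using (decidable-stable; map′; toSum; toWitness)
open import Relation.Unary using (_≐_)

-- Only one half of each isometry is ever built. A comparison of forms is a bare function on vectors
-- that preserves the pairing (`_represents_`), so no change-of-basis matrix has to be inverted.
-- Nondegeneracy of the form at the source makes the function injective on lines, and since any two
-- systems of representatives have the same size, injectivity already yields the bijection of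
-- vertices. The facts about squares come from finiteness in the same way, as surjectivity of an
-- injective self-map of the field, and not from counting squares or from a cyclic multiplicative
-- group. Equality in the field is decidable through the enumeration by `Fin q`, so anisotropic
-- vectors, pivots and nonsquares are found by finite search. The classification splits on whether 1
-- + 1 = 0. The parity of `q` is translated into this once, by letting translation by 1 permute the
-- field.

injective⇒surjective : ∀ {n} {f : Fin n → Fin n} → Injective _≡_ _≡_ f →
                       ∀ y → ∃[ x ] f x ≡ y
injective⇒surjective {suc n} {f} f-inj y with any? (λ x → f x ≟ y)
... | yes fx≡y = fx≡y
-- Punching a missed value out of the codomain would inject `Fin (suc n)` into `Fin n`.
... | no  ∄x   = contradiction (injective⇒≤ avoid-injective) ℕ.1+n≰n
  where
  y≢f : ∀ x → ¬ (y ≡ f x)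
  y≢f x y≡fx = ∄x (x , ≡.sym y≡fx)
  avoid-injective : Injective _≡_ _≡_ (λ x → punchOut (y≢f x))
  avoid-injective {i} {j} eq = f-inj (punchOut-injective (y≢f i) (y≢f j) eq)

2∣^⇒2∣ : ∀ p e → 2 ∣ p ^ e → 2 ∣ p
2∣^⇒2∣ p zero    2∣1 = contradiction (∣1⇒≡1 2∣1) λ ()
2∣^⇒2∣ p (suc e) 2∣  with euclidsLemma p (p ^ e) (toWitness {a? = prime? 2} _) 2∣
... | inj₁ 2∣p  = 2∣p
... | inj₂ 2∣pᵉ = 2∣^⇒2∣ p e 2∣pᵉ

-- Squares, sums of two squares and the characteristic of a finite field

module FieldArithmetic {q : ℕ} {c ℓ : Level} (F : FiniteField q c ℓ) where

  open Over F
  open FiniteField F using (commutativeRing; 1≉0; inverse; finite)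
  open CommutativeRing commutativeRing using
    ( _+_; -_; +-cong; +-congˡ; +-congʳ; +-assoc; +-identityˡ; +-identityʳ; *-cong
    ; *-identityˡ; *-identityʳ; zeroˡ; zeroʳ; distribˡ; distribʳ; -‿cong; -‿inverseˡ
    ; -‿inverseʳ; ring; +-group; +-commutativeMonoid; commutativeSemiring; reflexive
    )
  open import Algebra.Properties.Group +-group
    using (inverseˡ-unique; ⁻¹-involutive; ∙-cancelʳ; ∙-cancelˡ)
  open import Algebra.Properties.Ring ring using (-‿distribʳ-*)
  open import Algebra.Properties.CommutativeMonoid.Sum +-commutativeMonoid
    using (sum-permute; ∑-distrib-+; sum-replicate)
  open import Algebra.Properties.Semiring.Mult semiring
    using (×-homo-+; ×1-homo-*; ×-congˡ) renaming (_×_ to _⋆_)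
  open import Algebra.Solver.Ring.NaturalCoefficients.Default commutativeSemiring
    using (solve; _:=_; _:+_; _:*_; con)
  open import Relation.Binary.Reasoning.Setoid ≈-setoid

  index : Carrier → Fin q
  index = Inverse.to finite

  element : Fin q → Carrier
  element = Inverse.from finite

  element-index : ∀ x → element (index x) ≈ x
  element-index = Inverse.strictlyInverseʳ finite

  index-element : ∀ i → index (element i) ≡ i
  index-element = Inverse.strictlyInverseˡ finite

  index-injective : ∀ {x y} → index x ≡ index y → x ≈ y
  index-injective {x} {y} eq = begin
    x                  ≈⟨ element-index x ⟨
    element (index x)  ≈⟨ reflexive (≡.cong element eq) ⟩
    element (index y)  ≈⟨ element-index y ⟩
    y                  ∎

  infix 4 _≈?_

  _≈?_ : ∀ x y → Dec (x ≈ y)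
  x ≈? y = map′ index-injective (Inverse.to-cong finite) (index x ≟ index y)

  isSquare? : ∀ a → Dec (IsSquare a)
  isSquare? a = map′
    (λ (i , eq) → element i , eq)
    (λ (x , eq) → index x , ≈-trans (*-cong (element-index x) (element-index x)) eq)
    (any? λ i → element i · element i ≈? a)

  abstract
    -- Conjugating by the enumeration gives an injective self-map of `Fin q`. Preimages are sought
    -- among the canonical elements `element i`, so `f` may be a bare function on `Carrier`.
    endo-injective⇒surjective : (f : Carrier → Carrier) → (∀ x y → f x ≈ f y → x ≈ y) →
                                ∀ y → ∃[ x ] (f x ≈ y)
    endo-injective⇒surjective f f-inj y with injective⇒surjective {f = index ∘ f ∘ element}
      (λ {i} {j} eq → ≡.trans (≡.sym (index-element i))
        (≡.trans (Inverse.to-cong finite (f-inj _ _ (index-injective eq))) (index-element j)))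
      (index y)
    ... | i , eq = element i , index-injective eq

  ·-cancelˡ : ∀ {a x y} → ¬ (a ≈ 0#) → a · x ≈ a · y → x ≈ y
  ·-cancelˡ {a} {x} {y} a≉0 eq with inverse a a≉0
  ... | b , ab≈1 = begin
    x            ≈⟨ unit x ⟨
    b · (a · x)  ≈⟨ *-congˡ eq ⟩
    b · (a · y)  ≈⟨ unit y ⟩
    y            ∎
    where
    unit : ∀ z → b · (a · z) ≈ z
    unit z = begin
      b · (a · z)  ≈⟨ *-assoc b a z ⟨
      b · a · z    ≈⟨ *-congʳ (≈-trans (*-comm b a) ab≈1) ⟩
      1# · z       ≈⟨ *-identityˡ z ⟩
      z            ∎

  ·-noZeroDivisor : ∀ {a x} → ¬ (a ≈ 0#) → a · x ≈ 0# → x ≈ 0#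
  ·-noZeroDivisor {a} a≉0 ax≈0 = ·-cancelˡ a≉0 (≈-trans ax≈0 (≈-sym (zeroʳ a)))

  ·-nonzero : ∀ {a b} → ¬ (a ≈ 0#) → ¬ (b ≈ 0#) → ¬ (a · b ≈ 0#)
  ·-nonzero a≉0 b≉0 ab≈0 = b≉0 (·-noZeroDivisor a≉0 ab≈0)

  x·x≈0⇒x≈0 : ∀ {x} → x · x ≈ 0# → x ≈ 0#
  x·x≈0⇒x≈0 {x} xx≈0 with x ≈? 0#
  ... | yes x≈0 = x≈0
  ... | no  x≉0 = ·-noZeroDivisor x≉0 xx≈0

  inverse-nonzero : ∀ {a b} → a · b ≈ 1# → ¬ (b ≈ 0#)
  inverse-nonzero {a} ab≈1 b≈0 =
    1≉0 (≈-trans (≈-sym ab≈1) (≈-trans (*-congˡ b≈0) (zeroʳ a)))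

  -- Describing -1/a by the equation 1 + a s = 0 keeps negation out of later identities, so that the
  -- semiring solver can prove them. It supplies the projection coefficients in `splitLine`.
  negatedInverse : ∀ {a} → ¬ (a ≈ 0#) → ∃[ s ] (1# + a · s ≈ 0#)
  negatedInverse {a} a≉0 with inverse a a≉0
  ... | b , ab≈1 = - b , (begin
    1# + a · - b    ≈⟨ +-congˡ (-‿distribʳ-* a b) ⟨
    1# + - (a · b)  ≈⟨ +-congˡ (-‿cong ab≈1) ⟩
    1# + - 1#       ≈⟨ -‿inverseʳ 1# ⟩
    0#              ∎)

  x·x≈y·y⇒x≈±y : ∀ x y → x · x ≈ y · y → x ≈ y ⊎ x ≈ - y
  x·x≈y·y⇒x≈±y x y eq with x + y ≈? 0#
  ... | yes x+y≈0 = inj₂ (inverseˡ-unique x y x+y≈0)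
  ... | no  x+y≉0 = inj₁ (·-cancelˡ x+y≉0 (begin
    (x + y) · x    ≈⟨ solve 2 (λ x y → (x :+ y) :* x := x :* x :+ x :* y) ≈-refl x y ⟩
    x · x + x · y  ≈⟨ +-congʳ eq ⟩
    y · y + x · y  ≈⟨ solve 2 (λ x y → y :* y :+ x :* y := (x :+ y) :* y) ≈-refl x y ⟩
    (x + y) · y    ∎))

  char2⇒x+x≈0 : 1# + 1# ≈ 0# → ∀ x → x + x ≈ 0#
  char2⇒x+x≈0 2≈0 x = begin
    x + x            ≈⟨ solve 1 (λ x → x :+ x := con 2 :* x) ≈-refl x ⟩
    (1# + 1#) · x    ≈⟨ *-congʳ 2≈0 ⟩
    0# · x           ≈⟨ zeroˡ x ⟩
    0#               ∎

  abstract
    -- Squaring is additive in characteristic 2, so x² = y² gives (x + y)² = 0 and hence x = y; the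
    -- injective map is then onto by finiteness.
    char2⇒isSquare : 1# + 1# ≈ 0# → ∀ a → IsSquare a
    char2⇒isSquare 2≈0 = endo-injective⇒surjective (λ x → x · x) λ x y eq →
      ∙-cancelʳ y x y (begin
        x + y  ≈⟨ x·x≈0⇒x≈0 (begin
          (x + y) · (x + y)
            ≈⟨ solve 2 (λ x y → (x :+ y) :* (x :+ y) := x :* x :+ y :* y :+ con 2 :* (x :* y)) ≈-refl x y ⟩
          x · x + y · y + (1# + 1#) · (x · y)
            ≈⟨ +-cong (≈-trans (+-congʳ eq) (char2⇒x+x≈0 2≈0 (y · y))) (≈-trans (*-congʳ 2≈0) (zeroˡ _)) ⟩
          0# + 0#
            ≈⟨ +-identityʳ 0# ⟩
          0# ∎) ⟩
        0#     ≈⟨ char2⇒x+x≈0 2≈0 y ⟨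
        y + y  ∎)

  abstract
    -- The map sending x to x² on one half of the field (one member of each pair ±x) and
    -- to ax² on the other half is injective, hence surjective.
    square-or-multiple : ∀ {a} → ¬ IsSquare a → ∀ b → IsSquare b ⊎ ∃[ x ] (a · (x · x) ≈ b)
    square-or-multiple {a} a-nonsquare b = conclude (endo-injective⇒surjective f f-injective b)
      where
      Half : Carrier → Set
      Half x = toℕ (index x) ℕ.≤ toℕ (index (- x))
      half? : ∀ x → Dec (Half x)
      half? x = toℕ (index x) ℕ.≤? toℕ (index (- x))

      f : Carrier → Carrier
      f x with half? x
      ... | yes _ = x · x
      ... | no  _ = a · (x · x)

      index-cong : ∀ {x y} → x ≈ y → toℕ (index x) ≡ toℕ (index y)
      index-cong = ≡.cong toℕ ∘ Inverse.to-cong finite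
      opposite : ∀ {x y} → x ≈ - y → - x ≈ y
      opposite {y = y} x≈-y = ≈-trans (-‿cong x≈-y) (⁻¹-involutive y)

      a≉0 : ¬ (a ≈ 0#)
      a≉0 a≈0 = a-nonsquare (0# , ≈-trans (zeroˡ 0#) (≈-sym a≈0))

      -- For nonzero y the equation would exhibit a as the square of x/y. The case y = 0 cannot
      -- occur outside the half, since 0 equals its own negative.
      mixed : ∀ x y → ¬ Half y → ¬ (x · x ≈ a · (y · y))
      mixed x y ¬half eq with y ≈? 0#
      ... | yes y≈0 = ¬half (ℕ.≤-reflexive (index-cong (≈-sym (opposite (inverseˡ-unique y y
                        (≈-trans (+-cong y≈0 y≈0) (+-identityʳ 0#)))))))
      ... | no  y≉0 with inverse y y≉0
      ...   | z , yz≈1 = a-nonsquare (x · z , (begin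
        x · z · (x · z)
          ≈⟨ solve 2 (λ x z → x :* z :* (x :* z) := x :* x :* (z :* z)) ≈-refl x z ⟩
        x · x · (z · z)            ≈⟨ *-congʳ eq ⟩
        a · (y · y) · (z · z)
          ≈⟨ solve 3 (λ a y z → a :* (y :* y) :* (z :* z) := a :* (y :* z :* (y :* z))) ≈-refl a y z ⟩
        a · (y · z · (y · z))      ≈⟨ *-congˡ (*-cong yz≈1 yz≈1) ⟩
        a · (1# · 1#)              ≈⟨ *-congˡ (*-identityˡ 1#) ⟩
        a · 1#                     ≈⟨ *-identityʳ a ⟩
        a                          ∎))

      f-injective : ∀ x y → f x ≈ f y → x ≈ y
      f-injective x y eq with half? x | half? y
      ... | yes _  | no ¬hy = contradiction eq (mixed x y ¬hy)
      ... | no ¬hx | yes _  = contradiction (≈-sym eq) (mixed y x ¬hx)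
      ... | yes hx | yes hy with x·x≈y·y⇒x≈±y x y eq
      ...   | inj₁ x≈y  = x≈y
      -- From x = -y the two memberships in the half read as index x ≤ index y and index y ≤ index
      -- x.
      ...   | inj₂ x≈-y = index-injective (toℕ-injective (ℕ.≤-antisym
        (ℕ.≤-trans hx (ℕ.≤-reflexive (index-cong (opposite x≈-y))))
        (ℕ.≤-trans hy (ℕ.≤-reflexive (index-cong (≈-sym x≈-y))))))
      f-injective x y eq | no ¬hx | no ¬hy with x·x≈y·y⇒x≈±y x y (·-cancelˡ a≉0 eq)
      ...   | inj₁ x≈y  = x≈y
      ...   | inj₂ x≈-y = index-injective (toℕ-injective (ℕ.≤-antisym
        (ℕ.≤-trans (ℕ.≤-reflexive (index-cong x≈-y)) (ℕ.<⇒≤ (ℕ.≰⇒> ¬hy)))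
        (ℕ.≤-trans (ℕ.≤-reflexive (index-cong (≈-sym (opposite x≈-y)))) (ℕ.<⇒≤ (ℕ.≰⇒> ¬hx)))))

      conclude : ∃[ x ] (f x ≈ b) → IsSquare b ⊎ ∃[ x ] (a · (x · x) ≈ b)
      conclude (x , fx≈b) with half? x
      ... | yes _ = inj₁ (x , fx≈b)
      ... | no  _ = inj₂ (x , fx≈b)

  -- If n = x² then n + 1 = 1 + x² is again a square. Since some multiple of 1 equals -1, this
  -- produces a square root of -1.
  multiple-isSquare : (∀ x → IsSquare (1# + x · x)) → ∀ n → IsSquare (n ⋆ 1#)
  multiple-isSquare closed zero = 0# , zeroˡ 0#
  multiple-isSquare closed (suc n) with multiple-isSquare closed n
  ... | x , x²≈n with closed x
  ...   | y , y²≈1+x² = y , ≈-trans y²≈1+x² (+-congˡ x²≈n)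

  -- Some multiple d·1 equals -1.
  squares-closed⇒-1-square : (∀ x → IsSquare (1# + x · x)) → ∃[ s ] (1# + s · s ≈ 0#)
  squares-closed⇒-1-square closed
    -- Two of the q + 1 multiples 0·1, ..., q·1 coincide. Writing j = i + 1 + d makes (1 + d)·1
    -- vanish, so d·1 is -1.
    with i , j , i<j , eq ← pigeonhole (ℕ.n<1+n q) (λ i → index (toℕ i ⋆ 1#))
    with d , refl-j ← ℕ.m≤n⇒∃[o]m+o≡n i<j
    with s , s²≈d ← multiple-isSquare closed d
    = s , (begin
      1# + s · s        ≈⟨ +-congˡ s²≈d ⟩
      suc d ⋆ 1#        ≈⟨ ∙-cancelˡ (toℕ i ⋆ 1#) (suc d ⋆ 1#) 0# (begin
        toℕ i ⋆ 1# + suc d ⋆ 1#    ≈⟨ ×-homo-+ 1# (toℕ i) (suc d) ⟨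
        (toℕ i ℕ.+ suc d) ⋆ 1#     ≈⟨ ×-congˡ (≡.trans (ℕ.+-suc (toℕ i) d) refl-j) ⟩
        toℕ j ⋆ 1#                 ≈⟨ index-injective eq ⟨
        toℕ i ⋆ 1#                 ≈⟨ +-identityʳ _ ⟨
        toℕ i ⋆ 1# + 0#            ∎) ⟩
      0#                ∎)

  abstract
    -- Either some 1 + x² is a nonsquare, and then every nonsquare is a square multiple
    -- of it, or -1 is a square and d = 2v + 1 = (v + 1)² - v².
    sumOfTwoSquares : ¬ (1# + 1# ≈ 0#) → ∀ d → ∃₂ λ x y → x · x + y · y ≈ d
    sumOfTwoSquares 2≉0 d with any? (λ i → ¬? (isSquare? (1# + element i · element i)))
    ... | yes (i , nonsquare) with square-or-multiple nonsquare d
    ...   | inj₁ (x , x²≈d) = x , 0# , ≈-trans (+-congˡ (zeroˡ 0#)) (≈-trans (+-identityʳ _) x²≈d)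
    ...   | inj₂ (y , eq)   = y , element i · y , ≈-trans
      (solve 2 (λ x y → y :* y :+ x :* y :* (x :* y) := (con 1 :+ x :* x) :* (y :* y)) ≈-refl (element i) y)
      eq
    sumOfTwoSquares 2≉0 d | no squares
      with s , 1+s²≈0 ← squares-closed⇒-1-square (λ x →
             let y , eq = decidable-stable (isSquare? _) (λ nonsquare → squares (index x , nonsquare))
             in  y , ≈-trans eq (+-congˡ (*-cong (element-index x) (element-index x))))
      with h , 2h≈1 ← inverse (1# + 1#) 2≉0
      = v + 1# , s · v , (begin
        (v + 1#) · (v + 1#) + s · v · (s · v)
          ≈⟨ solve 3 (λ v s e → (v :+ e) :* (v :+ e) :+ s :* v :* (s :* v)
                        := (v :* e :+ v :* e) :+ e :* e :+ (v :* v :+ s :* s :* (v :* v))) ≈-refl v s 1# ⟩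
        (v · 1# + v · 1#) + 1# · 1# + (v · v + s · s · (v · v))
          ≈⟨ +-cong (+-cong (≈-sym (distribˡ v 1# 1#)) (*-identityʳ 1#)) (+-congʳ (≈-sym (*-identityˡ (v · v)))) ⟩
        v · (1# + 1#) + 1# + (1# · (v · v) + s · s · (v · v))
          ≈⟨ +-cong (+-congʳ (≈-trans (*-assoc _ h _) (≈-trans (*-congˡ (≈-trans (*-comm h _) 2h≈1)) (*-identityʳ _))))
                    (≈-sym (distribʳ (v · v) 1# (s · s))) ⟩
        (d + - 1#) + 1# + (1# + s · s) · (v · v)
          ≈⟨ +-cong (≈-trans (+-assoc d (- 1#) 1#) (≈-trans (+-congˡ (-‿inverseˡ 1#)) (+-identityʳ d)))
                    (≈-trans (*-congʳ 1+s²≈0) (zeroˡ _)) ⟩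
        d + 0#
          ≈⟨ +-identityʳ d ⟩
        d ∎)
      where
      v : Carrier
      v = (d + - 1#) · h

  abstract
    -- If 1/a or 1/b is a square, one variable suffices. If neither is, they differ by a square
    -- factor z², so b z² = a; substituting z y for y turns the form into a(x² + y²), and 1/a is a
    -- sum of two squares.
    binaryFormRepresents1 : ¬ (1# + 1# ≈ 0#) → ∀ {a b} → ¬ (a ≈ 0#) → ¬ (b ≈ 0#) →
                            ∃₂ λ x y → a · (x · x) + b · (y · y) ≈ 1#
    binaryFormRepresents1 2≉0 {a} {b} a≉0 b≉0 with inverse a a≉0
    ... | a⁻¹ , aa⁻¹≈1 with isSquare? a⁻¹
    ...   | yes (x , x²≈a⁻¹) = x , 0# , ≈-trans
      (+-cong (*-congˡ x²≈a⁻¹) (≈-trans (*-congˡ (zeroˡ 0#)) (zeroʳ b)))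
      (≈-trans (+-identityʳ _) aa⁻¹≈1)
    ...   | no  a⁻¹-nonsquare with inverse b b≉0
    ...     | b⁻¹ , bb⁻¹≈1 with square-or-multiple a⁻¹-nonsquare b⁻¹
    ...       | inj₁ (y , y²≈b⁻¹) = 0# , y , ≈-trans
      (+-cong (≈-trans (*-congˡ (zeroˡ 0#)) (zeroʳ a)) (*-congˡ y²≈b⁻¹))
      (≈-trans (+-identityˡ _) bb⁻¹≈1)
    ...       | inj₂ (z , a⁻¹z²≈b⁻¹) with sumOfTwoSquares 2≉0 a⁻¹
    ...         | x , y , x²+y²≈a⁻¹ = x , z · y , (begin
      a · (x · x) + b · (z · y · (z · y))
        ≈⟨ +-congˡ (solve 3 (λ b z y → b :* (z :* y :* (z :* y)) := b :* (z :* z) :* (y :* y)) ≈-refl b z y) ⟩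
      a · (x · x) + b · (z · z) · (y · y)
        ≈⟨ +-congˡ (*-congʳ bz²≈a) ⟩
      a · (x · x) + a · (y · y)
        ≈⟨ distribˡ a _ _ ⟨
      a · (x · x + y · y)
        ≈⟨ *-congˡ x²+y²≈a⁻¹ ⟩
      a · a⁻¹
        ≈⟨ aa⁻¹≈1 ⟩
      1# ∎)
      where
      bz²≈a : b · (z · z) ≈ a
      bz²≈a = ·-cancelˡ (inverse-nonzero aa⁻¹≈1) (begin
        a⁻¹ · (b · (z · z))  ≈⟨ solve 3 (λ a b z → a :* (b :* z) := b :* (a :* z)) ≈-refl a⁻¹ b (z · z) ⟩
        b · (a⁻¹ · (z · z))  ≈⟨ *-congˡ a⁻¹z²≈b⁻¹ ⟩
        b · b⁻¹              ≈⟨ bb⁻¹≈1 ⟩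
        1#                   ≈⟨ aa⁻¹≈1 ⟨
        a · a⁻¹              ≈⟨ *-comm a a⁻¹ ⟩
        a⁻¹ · a              ∎)

  -- Translation by 1 permutes the field, so the sum S of all elements satisfies S = S + q·1.
  q⋆1≈0 : q ⋆ 1# ≈ 0#
  q⋆1≈0 = ∙-cancelˡ (sum element) (q ⋆ 1#) 0# (begin
    sum element + q ⋆ 1#                   ≈⟨ +-congˡ (sum-replicate q) ⟨
    sum element + sum {q} (λ _ → 1#)       ≈⟨ ∑-distrib-+ element (λ _ → 1#) ⟨
    sum (λ i → element i + 1#)             ≈⟨ sum-cong-≋ {q} (λ i → element-index (element i + 1#)) ⟨
    sum (λ i → element (index (element i + 1#)))  ≈⟨ sum-permute element translation ⟨
    sum element                            ≈⟨ +-identityʳ _ ⟨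
    sum element + 0#                       ∎)
    where
    shift : ∀ {x y} → x + y ≈ 0# → ∀ i → index (element (index (element i + x)) + y) ≡ i
    shift {x} {y} x+y≈0 i = ≡.trans (Inverse.to-cong finite (begin
      element (index (element i + x)) + y  ≈⟨ +-congʳ (element-index _) ⟩
      element i + x + y                    ≈⟨ +-assoc _ x y ⟩
      element i + (x + y)                  ≈⟨ +-congˡ x+y≈0 ⟩
      element i + 0#                       ≈⟨ +-identityʳ _ ⟩
      element i                            ∎)) (index-element i)
    translation : Permutation q q
    translation = permutation (λ i → index (element i + 1#)) (λ i → index (element i + - 1#))
      (shift (-‿inverseˡ 1#)) (shift (-‿inverseʳ 1#))

  -- Evenness of p^e forces p = 2. Then q·1 is a power of 2·1 and vanishes, so 2·1 vanishes because
  -- there are no zero divisors.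
  2∣q⇒char2 : IsPrimePower q → 2 ∣ q → 1# + 1# ≈ 0#
  2∣q⇒char2 (p , e , p-prime , _ , refl) 2∣pᵉ
    with prime⇒irreducible p-prime (2∣^⇒2∣ p e 2∣pᵉ)
  ... | inj₂ refl = ≈-trans (+-congˡ (≈-sym (+-identityʳ 1#))) (root e q⋆1≈0)
    where
    root : ∀ e → (2 ^ e) ⋆ 1# ≈ 0# → 2 ⋆ 1# ≈ 0#
    root zero    1⋆1≈0 = contradiction (≈-trans (≈-sym (+-identityʳ 1#)) 1⋆1≈0) 1≉0
    root (suc e) eq with 2 ⋆ 1# ≈? 0#
    ... | yes 2≈0 = 2≈0
    ... | no  2≉0 = root e (·-noZeroDivisor 2≉0 (≈-trans (≈-sym (×1-homo-* 2 (2 ^ e))) eq))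

-- Symmetric bilinear forms and the splitting of an anisotropic line

module QuadraticForms {q : ℕ} {c ℓ : Level} (F : FiniteField q c ℓ) where

  open Over F
  open import Data.Vec.Functional using (_∷_)
  open FiniteField F using (commutativeRing)
  open FieldArithmetic F
  open CommutativeRing commutativeRing using
    ( _+_; +-cong; +-congˡ; +-congʳ; +-identityˡ; +-identityʳ; *-identityʳ; zeroˡ; zeroʳ
    ; distribˡ; commutativeSemiring; reflexive
    )
  open import Algebra.Solver.Ring.NaturalCoefficients.Default commutativeSemiring
    using (solve; _:=_; _:+_; _:*_; con)
  open import Relation.Binary.Reasoning.Setoid ≈-setoid

  private
    variable
      n N : ℕ

  infixl 6 _⊹_

  _⊹_ : Vector Carrier n → Vector Carrier n → Vector Carrier n
  _⊹_ = zipWith _+_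

  𝟎 : Vector Carrier n
  𝟎 = replicate _ 0#

  basis : Fin n → Vector Carrier n
  basis zero    = 1# ∷ 𝟎
  basis (suc j) = 0# ∷ basis j

  basis-diagonal : ∀ (j : Fin n) → basis j j ≈ 1#
  basis-diagonal zero    = ≈-refl
  basis-diagonal (suc j) = basis-diagonal j

  record IsLinear {n} (φ : Vector Carrier n → Carrier) : Set (c ⊔ ℓ) where
    field
      cong        : ∀ {x y} → x ≈ⱽ y → φ x ≈ φ y
      additive    : ∀ x y → φ (x ⊹ y) ≈ φ x + φ y
      homogeneous : ∀ a x → φ (a • x) ≈ a · φ x

    vanishes-at-zero : ∀ {x} → x ≈ⱽ 𝟎 → φ x ≈ 0#
    vanishes-at-zero {x} x≈0 = begin
      φ x         ≈⟨ cong (λ i → ≈-trans (x≈0 i) (≈-sym (zeroˡ (x i)))) ⟩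
      φ (0# • x)  ≈⟨ homogeneous 0# x ⟩
      0# · φ x    ≈⟨ zeroˡ _ ⟩
      0#          ∎

  linear-on-tail : ∀ {φ : Vector Carrier (suc n) → Carrier} →
                   IsLinear φ → IsLinear (λ x → φ (0# ∷ x))
  linear-on-tail φ-linear = record
    { cong        = λ x≈y → cong λ { zero → ≈-refl ; (suc i) → x≈y i }
    ; additive    = λ x y → ≈-trans
        (cong λ { zero → ≈-sym (+-identityʳ 0#) ; (suc i) → ≈-refl }) (additive _ _)
    ; homogeneous = λ a x → ≈-trans
        (cong λ { zero → ≈-sym (zeroʳ a) ; (suc i) → ≈-refl }) (homogeneous a _)
    }
    where open IsLinear φ-linear

  -- This turns nondegeneracy, which quantifies over all vectors, into a finite search: a vector
  -- outside the radical has a basis vector not orthogonal to it. The recursion peels off the first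
  -- coordinate, x = x₀ e₀ + (0, tail x).
  zero-or-nonzero-on-basis : ∀ {φ : Vector Carrier n → Carrier} → IsLinear φ →
                             (∀ x → φ x ≈ 0#) ⊎ ∃[ j ] (¬ (φ (basis j) ≈ 0#))
  zero-or-nonzero-on-basis {zero}  φ-linear = inj₁ λ x → IsLinear.vanishes-at-zero φ-linear λ ()
  zero-or-nonzero-on-basis {suc n} {φ} φ-linear with φ (basis zero) ≈? 0#
  ... | no  φe≉0 = inj₂ (zero , φe≉0)
  ... | yes φe≈0 with zero-or-nonzero-on-basis (linear-on-tail φ-linear)
  ...   | inj₂ (j , φeⱼ≉0) = inj₂ (suc j , φeⱼ≉0)
  ...   | inj₁ vanishes = inj₁ λ x → begin
    φ x ≈⟨ cong {y = x zero • basis zero ⊹ (0# ∷ tail x)} (λ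
             { zero    → ≈-sym (≈-trans (+-identityʳ _) (*-identityʳ _))
             ; (suc i) → ≈-sym (≈-trans (+-congʳ (zeroʳ _)) (+-identityˡ _)) }) ⟩
    φ (x zero • basis zero ⊹ (0# ∷ tail x))         ≈⟨ additive _ _ ⟩
    φ (x zero • basis zero) + φ (0# ∷ tail x)       ≈⟨ +-cong (homogeneous _ _) (vanishes _) ⟩
    x zero · φ (basis zero) + 0#                    ≈⟨ +-identityʳ _ ⟩
    x zero · φ (basis zero)                         ≈⟨ *-congˡ φe≈0 ⟩
    x zero · 0#                                     ≈⟨ zeroʳ _ ⟩
    0#                                              ∎
    where open IsLinear φ-linear

  Pairing : ℕ → Set c
  Pairing n = Vector Carrier n → Vector Carrier n → Carrier

  Nondegenerate : Pairing n → Set (c ⊔ ℓ)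
  Nondegenerate β = ∀ x → (∀ y → β x y ≈ 0#) → x ≈ⱽ 𝟎

  record IsSymmetricBilinear {n} (β : Pairing n) : Set (c ⊔ ℓ) where
    field
      linear : ∀ x → IsLinear (β x)
      sym    : ∀ x y → β x y ≈ β y x

    module _ {x : Vector Carrier n} where
      open IsLinear (linear x) public

    congˡ : ∀ {x x′ y} → x ≈ⱽ x′ → β x y ≈ β x′ y
    congˡ {x} {x′} {y} x≈x′ = ≈-trans (sym x y) (≈-trans (cong x≈x′) (sym y x′))

    additiveˡ : ∀ x x′ y → β (x ⊹ x′) y ≈ β x y + β x′ y
    additiveˡ x x′ y = ≈-trans (sym _ y) (≈-trans (additive x x′) (+-cong (sym y x) (sym y x′)))

    homogeneousˡ : ∀ a x y → β (a • x) y ≈ a · β x y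
    homogeneousˡ a x y = ≈-trans (sym _ y) (≈-trans (homogeneous a x) (*-congˡ (sym y x)))

    translate-orthogonal : ∀ {v y} → β v y ≈ 0# → ∀ x t → β y (x ⊹ t • v) ≈ β y x
    translate-orthogonal {v} {y} v⊥y x t = begin
      β y (x ⊹ t • v)        ≈⟨ additive x _ ⟩
      β y x + β y (t • v)    ≈⟨ +-congˡ (homogeneous t v) ⟩
      β y x + t · β y v      ≈⟨ +-congˡ (*-congˡ (≈-trans (sym y v) v⊥y)) ⟩
      β y x + t · 0#         ≈⟨ +-congˡ (zeroʳ t) ⟩
      β y x + 0#             ≈⟨ +-identityʳ _ ⟩
      β y x                  ∎

  record NondegenerateForm (n : ℕ) : Set (c ⊔ ℓ) where
    field
      pairing             : Pairing n
      isSymmetricBilinear : IsSymmetricBilinear pairing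
      nondegenerate       : Nondegenerate pairing
    open IsSymmetricBilinear isSymmetricBilinear public

  open NondegenerateForm using (pairing)

  infix 4 _represents_

  -- No linearity is required of embed: when γ is nondegenerate, preserving the pairing already
  -- makes embed send non-proportional vectors to non-proportional ones.
  record _represents_ {N n} (β : Pairing N) (γ : Pairing n) : Set (c ⊔ ℓ) where
    constructor _,ᵣ_
    field
      embed     : Vector Carrier n → Vector Carrier N
      isometric : ∀ x y → β (embed x) (embed y) ≈ γ x y

  represents-trans : ∀ {k} {α : Pairing k} {β : Pairing N} {γ : Pairing n} →
                     α represents β → β represents γ → α represents γ
  represents-trans (f ,ᵣ f-iso) (g ,ᵣ g-iso) =
    (λ x → f (g x)) ,ᵣ λ x y → ≈-trans (f-iso (g x) (g y)) (g-iso x y)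

  represents-refl : {β γ : Pairing n} → (∀ x y → β x y ≈ γ x y) → β represents γ
  represents-refl β≈γ = (λ x → x) ,ᵣ β≈γ

  infixr 5 ⟨_⟩⊥_ ℍ⊥_

  ⟨_⟩⊥_ : Carrier → Pairing n → Pairing (suc n)
  (⟨ a ⟩⊥ β) x y = a · (x zero · y zero) + β (tail x) (tail y)

  ℍ⊥_ : Pairing n → Pairing (suc (suc n))
  (ℍ⊥ β) x y = x zero · y (suc zero) + x (suc zero) · y zero + β (tail (tail x)) (tail (tail y))

  ⟨⟩⊥-mono : ∀ a {β : Pairing N} {γ : Pairing n} →
             β represents γ → ⟨ a ⟩⊥ β represents ⟨ a ⟩⊥ γ
  ⟨⟩⊥-mono a (f ,ᵣ f-iso) = (λ x → x zero ∷ f (tail x)) ,ᵣ λ x y → +-congˡ (f-iso _ _)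

  ℍ⊥-mono : ∀ {β : Pairing N} {γ : Pairing n} → β represents γ → ℍ⊥ β represents ℍ⊥ γ
  ℍ⊥-mono (f ,ᵣ f-iso) =
    (λ x → x zero ∷ x (suc zero) ∷ f (tail (tail x))) ,ᵣ λ x y → +-congˡ (f-iso _ _)

  record LinearMap (n N : ℕ) : Set (c ⊔ ℓ) where
    field
      map         : Vector Carrier n → Vector Carrier N
      cong        : ∀ {x y} → x ≈ⱽ y → map x ≈ⱽ map y
      additive    : ∀ x y → map (x ⊹ y) ≈ⱽ map x ⊹ map y
      homogeneous : ∀ a x → map (a • x) ≈ⱽ a • map x

  -- For suitable φ and v this is the inclusion ι followed by orthogonal projection away from a
  -- line. `splitLine` uses it once, `splitHyperbolicPlane` twice.
  id-⊹-linear : LinearMap n N → (φ : Vector Carrier N → Carrier) → IsLinear φ →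
                Vector Carrier N → LinearMap n N
  id-⊹-linear ι φ φ-linear v = record
    { map         = λ z → map z ⊹ φ (map z) • v
    ; cong        = λ x≈y i → +-cong (cong x≈y i) (*-congʳ (φ.cong (cong x≈y)))
    ; additive    = λ x y i → begin
        map (x ⊹ y) i + φ (map (x ⊹ y)) · v i
          ≈⟨ +-cong (additive x y i) (*-congʳ (≈-trans (φ.cong (additive x y)) (φ.additive _ _))) ⟩
        map x i + map y i + (φ (map x) + φ (map y)) · v i
          ≈⟨ solve 5 (λ x y a b v → x :+ y :+ (a :+ b) :* v := x :+ a :* v :+ (y :+ b :* v)) ≈-refl _ _ _ _ _ ⟩
        map x i + φ (map x) · v i + (map y i + φ (map y) · v i) ∎
    ; homogeneous = λ a x i → begin
        map (a • x) i + φ (map (a • x)) · v i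
          ≈⟨ +-cong (homogeneous a x i) (*-congʳ (≈-trans (φ.cong (homogeneous a x)) (φ.homogeneous _ _))) ⟩
        a · map x i + a · φ (map x) · v i
          ≈⟨ solve 4 (λ a x b v → a :* x :+ a :* b :* v := a :* (x :+ b :* v)) ≈-refl _ _ _ _ ⟩
        a · (map x i + φ (map x) · v i) ∎
    }
    where
    open LinearMap ι
    module φ = IsLinear φ-linear

  insertAt-cong : ∀ {x y : Vector Carrier n} i {a b} → a ≈ b → x ≈ⱽ y →
                  insertAt x i a ≈ⱽ insertAt y i b
  insertAt-cong             zero    a≈b x≈y zero    = a≈b
  insertAt-cong             zero    a≈b x≈y (suc j) = x≈y j
  insertAt-cong {n = suc _} (suc i) a≈b x≈y zero    = x≈y zero
  insertAt-cong {n = suc _} (suc i) a≈b x≈y (suc j) = insertAt-cong i a≈b (λ k → x≈y (suc k)) j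

  insertAt-⊹ : ∀ (x y : Vector Carrier n) i {a b} →
               insertAt (x ⊹ y) i (a + b) ≈ⱽ insertAt x i a ⊹ insertAt y i b
  insertAt-⊹             x y zero    zero    = ≈-refl
  insertAt-⊹             x y zero    (suc j) = ≈-refl
  insertAt-⊹ {n = suc _} x y (suc i) zero    = ≈-refl
  insertAt-⊹ {n = suc _} x y (suc i) (suc j) = insertAt-⊹ (tail x) (tail y) i j

  insertAt-• : ∀ a (x : Vector Carrier n) i {b} → insertAt (a • x) i (a · b) ≈ⱽ a • insertAt x i b
  insertAt-•             a x zero    zero    = ≈-refl
  insertAt-•             a x zero    (suc j) = ≈-refl
  insertAt-• {n = suc _} a x (suc i) zero    = ≈-refl
  insertAt-• {n = suc _} a x (suc i) (suc j) = insertAt-• a (tail x) i j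

  insertZero : Fin (suc n) → LinearMap n (suc n)
  insertZero i = record
    { map         = λ x → insertAt x i 0#
    ; cong        = insertAt-cong i ≈-refl
    ; additive    = λ x y j → ≈-trans
        (insertAt-cong i (≈-sym (+-identityʳ 0#)) (λ _ → ≈-refl) j) (insertAt-⊹ x y i j)
    ; homogeneous = λ a x j → ≈-trans
        (insertAt-cong i (≈-sym (zeroʳ a)) (λ _ → ≈-refl) j) (insertAt-• a x i j)
    }

  infixr 9 _∘ᴸ_

  _∘ᴸ_ : ∀ {k} → LinearMap n N → LinearMap k n → LinearMap k N
  g ∘ᴸ h = record
    { map         = λ x → g.map (h.map x)
    ; cong        = λ x≈y → g.cong (h.cong x≈y)
    ; additive    = λ x y i → ≈-trans (g.cong (h.additive x y) i) (g.additive _ _ i)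
    ; homogeneous = λ a x i → ≈-trans (g.cong (h.homogeneous a x) i) (g.homogeneous a _ i)
    }
    where
    module g = LinearMap g
    module h = LinearMap h

  insertAt≈0⇒≈0 : ∀ {x : Vector Carrier n} i → insertAt x i 0# ≈ⱽ 𝟎 → x ≈ⱽ 𝟎
  insertAt≈0⇒≈0 {x = x} i eq j =
    ≈-trans (≈-sym (reflexive (insertAt-punchIn x i 0# j))) (eq (punchIn i j))

  removeAt-insertZero : ∀ (x : Vector Carrier (suc n)) i → x i ≈ 0# → x ≈ⱽ insertAt (removeAt x i) i 0#
  removeAt-insertZero x i xᵢ≈0 j =
    ≈-trans (≈-sym (reflexive (insertAt-removeAt x i j))) (insertAt-cong i xᵢ≈0 (λ _ → ≈-refl) j)

  -- The last hypothesis says that x differs from map z by a vector orthogonal to the image.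
  restrict : (β : NondegenerateForm N) (g : LinearMap n N) →
             (let open NondegenerateForm β using () renaming (pairing to B)
                  open LinearMap g using (map)) →
             (∀ w → map w ≈ⱽ 𝟎 → w ≈ⱽ 𝟎) →
             (∀ x → ∃[ z ] (∀ w → B (map w) x ≈ B (map w) (map z))) →
             NondegenerateForm n
  restrict β g injective spanning = record
    { pairing             = λ w z → B (map w) (map z)
    ; isSymmetricBilinear = record
      { linear = λ w → record
        { cong        = λ x≈y → β.cong (cong x≈y)
        ; additive    = λ x y → ≈-trans (β.cong (additive x y)) (β.additive _ _)
        ; homogeneous = λ a x → ≈-trans (β.cong (homogeneous a x)) (β.homogeneous _ _)
        }
      ; sym    = λ x y → β.sym _ _
      }
    ; nondegenerate       = λ w vanishes → injective w (β.nondegenerate (map w) λ x →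
        let z , eq = spanning x in ≈-trans (eq w) (vanishes z))
    }
    where
    module β = NondegenerateForm β
    open β using () renaming (pairing to B)
    open LinearMap g

  -- Choose a coordinate i with vᵢ nonzero. Every class modulo v has exactly one member with i-th
  -- coordinate 0, so inserting 0 at i and then projecting orthogonally to v parametrises the
  -- complement of v by vectors of length n.
  splitLine : (β : NondegenerateForm (suc n)) (v : Vector Carrier (suc n)) →
              (let a = pairing β v v) → ¬ (a ≈ 0#) →
              Σ[ γ ∈ NondegenerateForm n ] (pairing β represents ⟨ a ⟩⊥ pairing γ)
  splitLine {n} β v a≉0
    with s , 1+as≈0 ← negatedInverse a≉0
    with any? (λ i → ¬? (v i ≈? 0#))
  ... | no v≈0 = contradiction
    (NondegenerateForm.vanishes-at-zero β λ i → decidable-stable (v i ≈? 0#) λ vᵢ≉0 → v≈0 (i , vᵢ≉0)) a≉0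
  ... | yes (i , vᵢ≉0) = γ , (λ x → x zero • v ⊹ g.map (tail x)) ,ᵣ isometric
    where
    open NondegenerateForm β renaming (pairing to B)
    a = B v v

    φ-linear : IsLinear (λ x → s · B v x)
    φ-linear = record
      { cong        = λ x≈y → *-congˡ (cong x≈y)
      ; additive    = λ x y → ≈-trans (*-congˡ (additive x y)) (distribˡ s _ _)
      ; homogeneous = λ b x → ≈-trans (*-congˡ (homogeneous b x))
          (solve 3 (λ s b t → s :* (b :* t) := b :* (s :* t)) ≈-refl _ _ _)
      }
    g : LinearMap n (suc n)
    g = id-⊹-linear (insertZero i) (λ x → s · B v x) φ-linear v
    module g = LinearMap g

    orthogonal : ∀ z → B v (g.map z) ≈ 0#
    orthogonal z = begin
      B v (ẑ ⊹ (s · B v ẑ) • v)       ≈⟨ additive _ _ ⟩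
      B v ẑ + B v ((s · B v ẑ) • v)   ≈⟨ +-congˡ (homogeneous _ _) ⟩
      B v ẑ + s · B v ẑ · a
        ≈⟨ solve 3 (λ t s a → t :+ s :* t :* a := (con 1 :+ a :* s) :* t) ≈-refl _ s a ⟩
      (1# + a · s) · B v ẑ            ≈⟨ *-congʳ 1+as≈0 ⟩
      0# · B v ẑ                      ≈⟨ zeroˡ _ ⟩
      0#                              ∎
      where ẑ = insertAt z i 0#

    injective : ∀ z → g.map z ≈ⱽ 𝟎 → z ≈ⱽ 𝟎
    injective z gz≈0 = insertAt≈0⇒≈0 i λ j → begin
      ẑ j              ≈⟨ +-identityʳ _ ⟨
      ẑ j + 0#         ≈⟨ +-congˡ (≈-trans (*-congʳ t≈0) (zeroˡ _)) ⟨
      ẑ j + t · v j    ≈⟨ gz≈0 j ⟩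
      0#               ∎
      where
      ẑ = insertAt z i 0#
      t = s · B v ẑ
      t≈0 : t ≈ 0#
      t≈0 = ·-noZeroDivisor vᵢ≉0 (begin
        v i · t          ≈⟨ *-comm _ _ ⟩
        t · v i          ≈⟨ +-identityˡ _ ⟨
        0# + t · v i     ≈⟨ +-congʳ (reflexive (insertAt-lookup z i 0#)) ⟨
        ẑ i + t · v i    ≈⟨ gz≈0 i ⟩
        0#               ∎)

    spanning : ∀ x → ∃[ z ] (∀ w → B (g.map w) x ≈ B (g.map w) (g.map z))
    -- Pairing with the complement ignores multiples of v. With r = -1/vᵢ one such multiple clears
    -- the i-th coordinate of x, which makes it an inserted vector; a second one carries that vector
    -- to its projection.
    spanning x with r , 1+vᵢr≈0 ← negatedInverse vᵢ≉0 = z , λ w → begin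
      B (g.map w) x                               ≈⟨ translate-orthogonal (orthogonal w) _ _ ⟨
      B (g.map w) (x ⊹ (r · x i) • v)             ≈⟨ cong (removeAt-insertZero x′ i x′ᵢ≈0) ⟩
      B (g.map w) (insertAt z i 0#)               ≈⟨ translate-orthogonal (orthogonal w) _ _ ⟨
      B (g.map w) (g.map z)                       ∎
      where
      x′ = x ⊹ (r · x i) • v
      z = removeAt x′ i
      x′ᵢ≈0 : x′ i ≈ 0#
      x′ᵢ≈0 = ≈-trans
        (solve 3 (λ x r v → x :+ r :* x :* v := (con 1 :+ v :* r) :* x) ≈-refl _ r _)
        (≈-trans (*-congʳ 1+vᵢr≈0) (zeroˡ _))

    γ : NondegenerateForm n
    γ = restrict β g injective spanning

    isometric : ∀ x y → B (x zero • v ⊹ g.map (tail x)) (y zero • v ⊹ g.map (tail y))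
                        ≈ a · (x zero · y zero) + B (g.map (tail x)) (g.map (tail y))
    isometric x y = begin
      B (x₀ • v ⊹ gx) (y₀ • v ⊹ gy)
        ≈⟨ additiveˡ _ _ _ ⟩
      B (x₀ • v) (y₀ • v ⊹ gy) + B gx (y₀ • v ⊹ gy)
        ≈⟨ +-cong (homogeneousˡ x₀ v _) (additive _ _) ⟩
      x₀ · B v (y₀ • v ⊹ gy) + (B gx (y₀ • v) + B gx gy)
        ≈⟨ +-cong (*-congˡ (≈-trans (additive _ _) (≈-trans (+-cong (homogeneous y₀ v) (orthogonal _)) (+-identityʳ _))))
                  (+-congʳ (≈-trans (homogeneous y₀ v) (≈-trans (*-congˡ (≈-trans (sym _ _) (orthogonal _))) (zeroʳ y₀)))) ⟩
      x₀ · (y₀ · a) + (0# + B gx gy)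
        ≈⟨ +-cong (solve 3 (λ x y a → x :* (y :* a) := a :* (x :* y)) ≈-refl _ _ _) (+-identityˡ _) ⟩
      a · (x₀ · y₀) + B gx gy ∎
      where
      x₀ = x zero
      y₀ = y zero
      gx = g.map (tail x)
      gy = g.map (tail y)

-- Classification of nondegenerate forms up to similarity

module Classification {q : ℕ} {c ℓ : Level} (F : FiniteField q c ℓ) where

  open Over F
  open import Data.Vec.Functional using (_∷_)
  open FiniteField F using (commutativeRing; 1≉0; inverse)
  open FieldArithmetic F
  open QuadraticForms F
  open NondegenerateForm using (pairing)
  open CommutativeRing commutativeRing using
    ( _+_; -_; +-cong; +-congˡ; +-congʳ; +-assoc; +-identityʳ; *-identityˡ; *-identityʳ
    ; zeroˡ; zeroʳ; -‿cong; -‿inverseʳ; ring; +-group; commutativeSemiring; reflexive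
    )
  open import Algebra.Properties.Group +-group using (⁻¹-involutive)
  open import Algebra.Properties.Ring ring using (-‿distribˡ-*; -‿distribʳ-*)
  open import Algebra.Solver.Ring.NaturalCoefficients.Default commutativeSemiring
    using (solve; _:=_; _:+_; _:*_; con)
  open import Relation.Binary.Reasoning.Setoid ≈-setoid

  private
    variable
      n N : ℕ

  -- Rescaling v to w with B(u, w) = 1 gives a hyperbolic pair. The projection to its complement is
  -- z + B(w, z) u + B(u, z) w, with plus signs because 1 + 1 = 0. The pivots are the coordinates 0
  -- and `suc j`, where u and w are supported.
  splitHyperbolicPlane : 1# + 1# ≈ 0# → (β : NondegenerateForm (suc (suc n))) (j : Fin (suc n)) →
    (let open NondegenerateForm β using () renaming (pairing to B); u = basis zero; v = basis (suc j)) →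
    B u u ≈ 0# → B v v ≈ 0# → ¬ (B u v ≈ 0#) →
    Σ[ γ ∈ NondegenerateForm n ] (pairing β represents ℍ⊥ pairing γ)
  splitHyperbolicPlane {n} 2≈0 β j uu≈0 vv≈0 uv≉0
    with b⁻¹ , bb⁻¹≈1 ← inverse _ uv≉0
    = γ , (λ x → x zero • u ⊹ (x (suc zero) • w ⊹ g.map (tail (tail x)))) ,ᵣ isometric
    where
    open NondegenerateForm β renaming (pairing to B)
    u = basis zero
    v = basis (suc j)
    b = B u v
    w = b⁻¹ • v

    uw≈1 : B u w ≈ 1#
    uw≈1 = ≈-trans (homogeneous b⁻¹ v) (≈-trans (*-comm _ _) bb⁻¹≈1)

    ww≈0 : B w w ≈ 0#
    ww≈0 = begin
      B w w                ≈⟨ homogeneous b⁻¹ v ⟩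
      b⁻¹ · B w v          ≈⟨ *-congˡ (homogeneousˡ b⁻¹ v v) ⟩
      b⁻¹ · (b⁻¹ · B v v)  ≈⟨ *-congˡ (*-congˡ vv≈0) ⟩
      b⁻¹ · (b⁻¹ · 0#)     ≈⟨ *-congˡ (zeroʳ b⁻¹) ⟩
      b⁻¹ · 0#             ≈⟨ zeroʳ b⁻¹ ⟩
      0#                   ∎

    ι ι₁ g : LinearMap n (suc (suc n))
    ι  = insertZero zero ∘ᴸ insertZero j
    ι₁ = id-⊹-linear ι (B w) (linear w) u
    g  = id-⊹-linear ι₁ (B u) (linear u) w
    module ι = LinearMap ι
    module ι₁ = LinearMap ι₁
    module g = LinearMap g

    reflect : ∀ x {y z} → B x y ≈ 1# → B x (z ⊹ B x z • y) ≈ 0#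
    reflect x {y} {z} xy≈1 = begin
      B x (z ⊹ B x z • y)       ≈⟨ additive _ _ ⟩
      B x z + B x (B x z • y)   ≈⟨ +-congˡ (homogeneous _ y) ⟩
      B x z + B x z · B x y     ≈⟨ +-congˡ (≈-trans (*-congˡ xy≈1) (*-identityʳ _)) ⟩
      B x z + B x z             ≈⟨ char2⇒x+x≈0 2≈0 _ ⟩
      0#                        ∎

    u⊥g : ∀ z → B u (g.map z) ≈ 0#
    u⊥g z = reflect u uw≈1

    w⊥g : ∀ z → B w (g.map z) ≈ 0#
    -- The second correction is a multiple of w, which w does not see because it is isotropic.
    w⊥g z = ≈-trans (translate-orthogonal ww≈0 _ _) (reflect w (≈-trans (sym w u) uw≈1))

    injective : ∀ z → g.map z ≈ⱽ 𝟎 → z ≈ⱽ 𝟎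
    injective z gz≈0 = insertAt≈0⇒≈0 j λ i → insertAt≈0⇒≈0 zero ιz≈0 i
      where
      s = B w (ι.map z)
      t = B u (ι₁.map z)
      -- ιz vanishes at both pivots, and u and w are each supported at one of them. Reading g z = 0
      -- there isolates the two correction coefficients.
      s≈0 : s ≈ 0#
      s≈0 = begin
        s
          ≈⟨ solve 3 (λ s t c → s := con 0 :+ s :* con 1 :+ t :* (c :* con 0)) ≈-refl s t b⁻¹ ⟩
        0# + s · 1# + t · (b⁻¹ · 0#)           ≈⟨ gz≈0 zero ⟩
        0#                                     ∎
      t≈0 : t ≈ 0#
      t≈0 = ·-noZeroDivisor (inverse-nonzero bb⁻¹≈1) (begin
        b⁻¹ · t
          ≈⟨ solve 3 (λ s t c → c :* t := con 0 :+ s :* con 0 :+ t :* (c :* con 1)) ≈-refl s t b⁻¹ ⟩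
        0# + s · 0# + t · (b⁻¹ · 1#)             ≈⟨ +-cong (+-congʳ (reflexive (insertAt-lookup z j 0#)))
                                                      (*-congˡ (*-congˡ (basis-diagonal j))) ⟨
        g.map z (suc j)                          ≈⟨ gz≈0 (suc j) ⟩
        0#                                       ∎)
      ιz≈0 : ι.map z ≈ⱽ 𝟎
      ιz≈0 i = begin
        ι.map z i
          ≈⟨ solve 3 (λ z u w → z := z :+ con 0 :* u :+ con 0 :* w) ≈-refl _ (u i) (w i) ⟩
        ι.map z i + 0# · u i + 0# · w i        ≈⟨ +-cong (+-congˡ (*-congʳ s≈0)) (*-congʳ t≈0) ⟨
        g.map z i                              ≈⟨ gz≈0 i ⟩
        0#                                     ∎

    spanning : ∀ x → ∃[ z ] (∀ w → B (g.map w) x ≈ B (g.map w) (g.map z))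
    spanning x = z , λ y → begin
      B (g.map y) x                 ≈⟨ translate-orthogonal (u⊥g y) _ _ ⟨
      B (g.map y) (x ⊹ x zero • u)  ≈⟨ translate-orthogonal (w⊥g y) _ _ ⟨
      B (g.map y) x′                ≈⟨ cong x′≈ιz ⟩
      B (g.map y) (ι.map z)         ≈⟨ translate-orthogonal (u⊥g y) _ _ ⟨
      B (g.map y) (ι₁.map z)        ≈⟨ translate-orthogonal (w⊥g y) _ _ ⟨
      B (g.map y) (g.map z)         ∎
      where
      -- These multiples double the coordinates 0 and `suc j`, which kills them in characteristic 2;
      -- the factor b cancels the b⁻¹ in w.
      x′ = x ⊹ x zero • u ⊹ (x (suc j) · b) • w
      z = removeAt (tail x′) j
      x′≈ιz : x′ ≈ⱽ ι.map z
      x′≈ιz zero    = ≈-trans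
        (solve 3 (λ x y c → x :+ x :* con 1 :+ y :* (c :* con 0) := x :+ x) ≈-refl _ _ b⁻¹)
        (char2⇒x+x≈0 2≈0 _)
      x′≈ιz (suc i) = removeAt-insertZero (tail x′) j (begin
        x (suc j) + x zero · 0# + x (suc j) · b · (b⁻¹ · basis j j)
          ≈⟨ +-congˡ (*-congˡ (*-congˡ (basis-diagonal j))) ⟩
        x (suc j) + x zero · 0# + x (suc j) · b · (b⁻¹ · 1#)
          ≈⟨ solve 4 (λ x y b c → x :+ y :* con 0 :+ x :* b :* (c :* con 1) := x :+ x :* (b :* c)) ≈-refl _ _ b b⁻¹ ⟩
        x (suc j) + x (suc j) · (b · b⁻¹)
          ≈⟨ +-congˡ (≈-trans (*-congˡ bb⁻¹≈1) (*-identityʳ _)) ⟩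
        x (suc j) + x (suc j)
          ≈⟨ char2⇒x+x≈0 2≈0 _ ⟩
        0# ∎) i

    γ : NondegenerateForm n
    γ = restrict β g injective spanning

    expand : ∀ y s t r → B y (s • u ⊹ (t • w ⊹ r)) ≈ s · B y u + (t · B y w + B y r)
    expand y s t r = ≈-trans (additive _ _)
      (+-cong (homogeneous s u) (≈-trans (additive _ _) (+-congʳ (homogeneous t w))))

    isometric : ∀ x y → B (x zero • u ⊹ (x (suc zero) • w ⊹ g.map (tail (tail x))))
                          (y zero • u ⊹ (y (suc zero) • w ⊹ g.map (tail (tail y))))
      ≈ x zero · y (suc zero) + x (suc zero) · y zero + B (g.map (tail (tail x))) (g.map (tail (tail y)))
    isometric x y = begin
      B X Y
        ≈⟨ ≈-trans (sym X Y) (expand Y x₀ x₁ gx) ⟩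
      x₀ · B Y u + (x₁ · B Y w + B Y gx)
        ≈⟨ +-cong (*-congˡ (≈-trans (pair u uu≈0 uw≈1 (u⊥g _))
                              (solve 2 (λ s t → s :* con 0 :+ (t :* con 1 :+ con 0) := t) ≈-refl y₀ y₁)))
             (+-cong (*-congˡ (≈-trans (pair w (≈-trans (sym w u) uw≈1) ww≈0 (w⊥g _))
                                (solve 2 (λ s t → s :* con 1 :+ (t :* con 0 :+ con 0) := s) ≈-refl y₀ y₁)))
                     (≈-trans (pair gx (≈-trans (sym gx u) (u⊥g _)) (≈-trans (sym gx w) (w⊥g _)) ≈-refl)
                       (solve 3 (λ s t r → s :* con 0 :+ (t :* con 0 :+ r) := r) ≈-refl y₀ y₁ (B gx gy)))) ⟩
      x₀ · y₁ + (x₁ · y₀ + B gx gy)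
        ≈⟨ +-assoc _ _ _ ⟨
      x₀ · y₁ + x₁ · y₀ + B gx gy ∎
      where
      x₀ = x zero
      x₁ = x (suc zero)
      y₀ = y zero
      y₁ = y (suc zero)
      gx = g.map (tail (tail x))
      gy = g.map (tail (tail y))
      X = x₀ • u ⊹ (x₁ • w ⊹ gx)
      Y = y₀ • u ⊹ (y₁ • w ⊹ gy)
      pair : ∀ z {α δ ρ} → B z u ≈ α → B z w ≈ δ → B z gy ≈ ρ → B Y z ≈ y₀ · α + (y₁ · δ + ρ)
      pair z zu zw zg = ≈-trans (sym Y z) (≈-trans (expand z y₀ y₁ gy)
        (+-cong (*-congˡ zu) (+-cong (*-congˡ zw) zg)))

  -- If u = e₀ is isotropic, nondegeneracy provides a basis vector that is not orthogonal to u; it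
  -- is either anisotropic itself or isotropic and a partner for u. In characteristic 2 the second
  -- outcome gives the plane to split off, otherwise it leads to `anisotropic`.
  anisotropic-or-hyperbolic : (β : NondegenerateForm (suc n)) →
    (let open NondegenerateForm β using () renaming (pairing to B); u = basis zero) →
    ∃[ v ] (¬ (B v v ≈ 0#)) ⊎
    ∃[ j ] (let v = 0# ∷ basis j in B u u ≈ 0# × B v v ≈ 0# × ¬ (B u v ≈ 0#))
  anisotropic-or-hyperbolic β
    with pairing β (basis zero) (basis zero) ≈? 0#
  ... | no  uu≉0 = inj₁ (basis zero , uu≉0)
  ... | yes uu≈0
    with zero-or-nonzero-on-basis (NondegenerateForm.linear β (basis zero))
  ...   | inj₁ u⊥       = contradiction (NondegenerateForm.nondegenerate β (basis zero) u⊥ zero) 1≉0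
  ...   | inj₂ (zero , uu≉0) = contradiction uu≈0 uu≉0
  ...   | inj₂ (suc j , uv≉0)
    with pairing β (basis (suc j)) (basis (suc j)) ≈? 0#
  ...     | no  vv≉0 = inj₁ (basis (suc j) , vv≉0)
  ...     | yes vv≈0 = inj₂ (j , uu≈0 , vv≈0 , uv≉0)

  -- For isotropic u and v, B(u + v, u + v) = 2 B(u, v), which is nonzero.
  anisotropic : ¬ (1# + 1# ≈ 0#) → (β : NondegenerateForm (suc n)) →
                ∃[ v ] (¬ (pairing β v v ≈ 0#))
  anisotropic 2≉0 β with anisotropic-or-hyperbolic β
  ... | inj₁ anisotropic-vector = anisotropic-vector
  ... | inj₂ (j , uu≈0 , vv≈0 , uv≉0) = u ⊹ v , λ eq → ·-nonzero 2≉0 uv≉0 (begin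
    (1# + 1#) · B u v
      ≈⟨ solve 1 (λ b → con 2 :* b := con 0 :+ b :+ (b :+ con 0)) ≈-refl (B u v) ⟩
    0# + B u v + (B u v + 0#)
      ≈⟨ +-cong (+-congʳ uu≈0) (+-cong (sym v u) vv≈0) ⟨
    B u u + B u v + (B v u + B v v)
      ≈⟨ +-cong (additive u v) (additive u v) ⟨
    B u (u ⊹ v) + B v (u ⊹ v)
      ≈⟨ additiveˡ u v _ ⟨
    B (u ⊹ v) (u ⊹ v)
      ≈⟨ eq ⟩
    0# ∎)
    where
    open NondegenerateForm β renaming (pairing to B)
    u = basis zero
    v = basis (suc j)

  -- Defined by recursion on `⟨_⟩⊥_`, like `hyperbolic` on `ℍ⊥_`, so that splitting off one summand
  -- matches by computation. `diag-pairing` and `hyperbolic-pairing` connect them with the matrices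
  -- of the theorem.
  diagonal : Vector Carrier n → Pairing n
  diagonal {zero}  d x y = 0#
  diagonal {suc n} d     = ⟨ d zero ⟩⊥ diagonal (tail d)

  hyperbolic : ∀ h → Pairing (h ℕ.* 2)
  hyperbolic zero    x y = 0#
  hyperbolic (suc h)     = ℍ⊥ hyperbolic h

  scale-value : (β : NondegenerateForm n) → ∀ t v → pairing β (t • v) (t • v) ≈ t · t · pairing β v v
  scale-value β t v = ≈-trans (homogeneous t v) (≈-trans (*-congˡ (homogeneousˡ t v v)) (≈-sym (*-assoc t t _)))
    where open NondegenerateForm β

  splitUnit : (β : NondegenerateForm (suc n)) → ∃[ v ] (pairing β v v ≈ 1#) →
              Σ[ γ ∈ NondegenerateForm n ] (pairing β represents ⟨ 1# ⟩⊥ pairing γ)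
  splitUnit β (v , vv≈1) =
    let γ , β→γ = splitLine β v (λ vv≈0 → 1≉0 (≈-trans (≈-sym vv≈1) vv≈0))
    in  γ , represents-trans β→γ (represents-refl λ x y → +-congʳ (*-congʳ vv≈1))

  module Char2 (2≈0 : 1# + 1# ≈ 0#) where

    unitVector : (β : NondegenerateForm n) → ∃[ v ] (¬ (pairing β v v ≈ 0#)) →
                 ∃[ v ] (pairing β v v ≈ 1#)
    unitVector β (v , vv≉0)
      with b , vv·b≈1 ← inverse _ vv≉0
      with x , x²≈b ← char2⇒isSquare 2≈0 b
      = x • v , (begin
        pairing β (x • v) (x • v)  ≈⟨ scale-value β x v ⟩
        x · x · pairing β v v      ≈⟨ *-congʳ x²≈b ⟩
        b · pairing β v v          ≈⟨ *-comm b _ ⟩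
        pairing β v v · b          ≈⟨ vv·b≈1 ⟩
        1#                         ∎)

    -- If e is the unit vector and u, v is the hyperbolic pair, then e + u, e + v,
    -- e + u + v is an orthonormal basis.
    ⟨1⟩⊥ℍ⊥-orthonormal : (β : Pairing n) → ⟨ 1# ⟩⊥ ℍ⊥ β represents ⟨ 1# ⟩⊥ ⟨ 1# ⟩⊥ ⟨ 1# ⟩⊥ β
    ⟨1⟩⊥ℍ⊥-orthonormal {n} β = f ,ᵣ λ x y → ≈-trans
      (expand (x zero) (x (suc zero)) (x (suc (suc zero))) (y zero) (y (suc zero)) (y (suc (suc zero)))
        (β (tail (tail (tail x))) (tail (tail (tail y)))))
      (≈-trans (+-congˡ (≈-trans (*-congʳ 2≈0) (zeroˡ _))) (+-identityʳ _))
      where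
      f : Vector Carrier (suc (suc (suc n))) → Vector Carrier (suc (suc (suc n)))
      f x = (x zero + x (suc zero) + x (suc (suc zero)))
          ∷ (x zero + x (suc (suc zero)))
          ∷ (x (suc zero) + x (suc (suc zero)))
          ∷ tail (tail (tail x))
      expand : ∀ x₀ x₁ x₂ y₀ y₁ y₂ r →
        1# · ((x₀ + x₁ + x₂) · (y₀ + y₁ + y₂)) + ((x₀ + x₂) · (y₁ + y₂) + (x₁ + x₂) · (y₀ + y₂) + r)
        ≈ 1# · (x₀ · y₀) + (1# · (x₁ · y₁) + (1# · (x₂ · y₂) + r))
          + (1# + 1#) · (x₀ · y₁ + x₀ · y₂ + x₁ · y₂ + x₁ · y₀ + x₂ · y₀ + x₂ · y₁ + x₂ · y₂)
      expand = solve 7 (λ x₀ x₁ x₂ y₀ y₁ y₂ r →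
          con 1 :* ((x₀ :+ x₁ :+ x₂) :* (y₀ :+ y₁ :+ y₂))
          :+ ((x₀ :+ x₂) :* (y₁ :+ y₂) :+ (x₁ :+ x₂) :* (y₀ :+ y₂) :+ r)
        := con 1 :* (x₀ :* y₀) :+ (con 1 :* (x₁ :* y₁) :+ (con 1 :* (x₂ :* y₂) :+ r))
          :+ con 2 :* (x₀ :* y₁ :+ x₀ :* y₂ :+ x₁ :* y₂ :+ x₁ :* y₀ :+ x₂ :* y₀ :+ x₂ :* y₁ :+ x₂ :* y₂))
        ≈-refl

    ℍ⊥⟨⟩⊥-swap : ∀ a (β : Pairing n) → ℍ⊥ ⟨ a ⟩⊥ β represents ⟨ a ⟩⊥ ℍ⊥ β
    ℍ⊥⟨⟩⊥-swap a β =
      (λ x → x (suc zero) ∷ x (suc (suc zero)) ∷ x zero ∷ tail (tail (tail x))) ,ᵣ λ x y →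
      solve 4 (λ s t u r → s :+ t :+ (u :+ r) := u :+ (s :+ t :+ r)) ≈-refl
        (x (suc zero) · y (suc (suc zero))) (x (suc (suc zero)) · y (suc zero)) (a · (x zero · y zero))
        (β (tail (tail (tail x))) (tail (tail (tail y))))

    ⟨1⟩⊥hyperbolic-orthonormal : ∀ h →
      ⟨ 1# ⟩⊥ hyperbolic h represents diagonal (replicate (suc (h ℕ.* 2)) 1#)
    ⟨1⟩⊥hyperbolic-orthonormal zero    = represents-refl λ _ _ → ≈-refl
    ⟨1⟩⊥hyperbolic-orthonormal (suc h) = represents-trans (⟨1⟩⊥ℍ⊥-orthonormal (hyperbolic h))
      (⟨⟩⊥-mono 1# (⟨⟩⊥-mono 1# (⟨1⟩⊥hyperbolic-orthonormal h)))

    Classified : Pairing n → Set (c ⊔ ℓ)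
    Classified {n} β = β represents diagonal (replicate n 1#) ⊎
                       ∃[ h ] (n ≡ h ℕ.* 2 × β represents hyperbolic h)

    classified-⟨1⟩⊥ : {β : Pairing (suc n)} {γ : Pairing n} → β represents ⟨ 1# ⟩⊥ γ →
                      Classified γ → Classified β
    classified-⟨1⟩⊥ β→1⊥γ (inj₁ γ→1)              = inj₁ (represents-trans β→1⊥γ (⟨⟩⊥-mono 1# γ→1))
    classified-⟨1⟩⊥ β→1⊥γ (inj₂ (h , refl , γ→ℍ)) = inj₁
      (represents-trans β→1⊥γ (represents-trans (⟨⟩⊥-mono 1# γ→ℍ) (⟨1⟩⊥hyperbolic-orthonormal h)))

    -- If the complement contains a unit line, that line is moved to the front and absorbs the plane
    -- into three unit lines; if it is hyperbolic, the plane joins the others.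
    classified-ℍ⊥ : {β : Pairing (suc (suc n))} {γ : Pairing n} → β represents ℍ⊥ γ →
                    Classified γ → Classified β
    classified-ℍ⊥ β→ℍ⊥γ (inj₂ (h , refl , γ→ℍ)) = inj₂ (suc h , refl , represents-trans β→ℍ⊥γ (ℍ⊥-mono γ→ℍ))
    -- In rank 0 no unit line is available to absorb the plane, but the zero pairing is also
    -- `hyperbolic 0`.
    classified-ℍ⊥ {n = zero}  β→ℍ⊥γ (inj₁ γ→1) = inj₂ (1 , refl , represents-trans β→ℍ⊥γ (ℍ⊥-mono γ→1))
    classified-ℍ⊥ {n = suc n} β→ℍ⊥γ (inj₁ γ→1) = inj₁
      (represents-trans β→ℍ⊥γ (represents-trans (ℍ⊥-mono γ→1)
        (represents-trans (ℍ⊥⟨⟩⊥-swap 1# 𝟏ₙ) (⟨1⟩⊥ℍ⊥-orthonormal 𝟏ₙ))))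
      where 𝟏ₙ = diagonal (replicate n 1#)

    classify : (β : NondegenerateForm n) → Classified (pairing β)
    classify {zero} β = inj₁ (represents-refl λ x y → NondegenerateForm.vanishes-at-zero β λ ())
    classify {suc n} β with anisotropic-or-hyperbolic β
    ... | inj₁ anisotropic-vector =
      let γ , β→1⊥γ = splitUnit β (unitVector β anisotropic-vector)
      in  classified-⟨1⟩⊥ β→1⊥γ (classify γ)
    classify {suc (suc n)} β | inj₂ (j , uu≈0 , vv≈0 , uv≉0) =
      let γ , β→ℍ⊥γ = splitHyperbolicPlane 2≈0 β j uu≈0 vv≈0 uv≉0
      in  classified-ℍ⊥ β→ℍ⊥γ (classify γ)

  module CharNot2 (2≉0 : ¬ (1# + 1# ≈ 0#)) where

    -- An anisotropic v and an anisotropic w in its complement span a binary form with nonzero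
    -- coefficients, and such a form takes the value 1. This is where rank at least 2 enters.
    unitVector : (β : NondegenerateForm (suc (suc n))) → ∃[ v ] (pairing β v v ≈ 1#)
    unitVector β
      = let v , vv≉0 = anisotropic 2≉0 β
            γ , β→γ = splitLine β v vv≉0
            open _represents_ β→γ renaming (embed to f; isometric to f-iso)
            w , ww≉0 = anisotropic 2≉0 γ
            x , y , eq = binaryFormRepresents1 2≉0 vv≉0 ww≉0
        in f (x ∷ y • w) , (begin
        pairing β (f (x ∷ y • w)) (f (x ∷ y • w))                       ≈⟨ f-iso _ _ ⟩
        pairing β v v · (x · x) + pairing γ (y • w) (y • w)             ≈⟨ +-congˡ (scale-value γ y w) ⟩
        pairing β v v · (x · x) + y · y · pairing γ w w                 ≈⟨ +-congˡ (*-comm _ _) ⟩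
        pairing β v v · (x · x) + pairing γ w w · (y · y)               ≈⟨ eq ⟩
        1#                                                              ∎)

    represents-line : (β : NondegenerateForm n) (δ : Vector Carrier 1) →
                      ∀ v → pairing β v v ≈ δ zero → pairing β represents diagonal δ
    represents-line β δ v vv≈δ = (λ x → x zero • v) ,ᵣ λ x y → begin
      pairing β (x zero • v) (y zero • v)         ≈⟨ homogeneous _ _ ⟩
      y zero · pairing β (x zero • v) v           ≈⟨ *-congˡ (homogeneousˡ _ _ _) ⟩
      y zero · (x zero · pairing β v v)           ≈⟨ *-congˡ (*-congˡ vv≈δ) ⟩
      y zero · (x zero · δ zero)
        ≈⟨ solve 3 (λ x y d → y :* (x :* d) := d :* (x :* y) :+ con 0) ≈-refl _ _ _ ⟩
      δ zero · (x zero · y zero) + 0#             ∎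
      where open NondegenerateForm β

    -- Unit lines are split off down to rank 1. The value a on the last line can be altered by
    -- nonzero squares only, so the square class of 1/a decides between 1 and ν.
    classify : ∀ {ν} → ¬ IsSquare ν → ∀ {n} (β : NondegenerateForm (suc n)) →
      pairing β represents diagonal (replicate (suc n) 1#) ⊎
      pairing β represents diagonal (insertAt (replicate n 1#) (fromℕ n) ν)
    classify {ν} ν-nonsquare {zero} β = Sum.map
      (λ (x , x²≈b) → represents-line β (replicate 1 1#) (x • v) (begin
        pairing β (x • v) (x • v)                 ≈⟨ scale-value β x v ⟩
        x · x · a                                 ≈⟨ *-congʳ x²≈b ⟩
        b · a                                     ≈⟨ *-comm b a ⟩
        a · b                                     ≈⟨ ab≈1 ⟩
        1#                                        ∎))
      -- Here ν x² = 1/a, so the multiple of v by ν x has value ν² x² a = ν.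
      (λ (x , νx²≈b) → represents-line β (insertAt (replicate 0 1#) zero ν) ((ν · x) • v) (begin
        pairing β ((ν · x) • v) ((ν · x) • v)     ≈⟨ scale-value β _ v ⟩
        ν · x · (ν · x) · a                       ≈⟨ rearrange ν x a ⟩
        ν · (a · (ν · (x · x)))                   ≈⟨ *-congˡ (≈-trans (*-congˡ νx²≈b) ab≈1) ⟩
        ν · 1#                                    ≈⟨ *-identityʳ ν ⟩
        ν                                         ∎))
      (square-or-multiple ν-nonsquare b)
      where
      v = proj₁ (anisotropic 2≉0 β)
      a = pairing β v v
      b = proj₁ (inverse a (proj₂ (anisotropic 2≉0 β)))
      ab≈1 = proj₂ (inverse a (proj₂ (anisotropic 2≉0 β)))
      rearrange : ∀ ν x a → ν · x · (ν · x) · a ≈ ν · (a · (ν · (x · x)))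
      rearrange = solve 3 (λ ν x a → ν :* x :* (ν :* x) :* a := ν :* (a :* (ν :* (x :* x)))) ≈-refl
    classify ν-nonsquare {suc n} β
      = let γ , β→1⊥γ = splitUnit β (unitVector β)
        in  Sum.map (λ γ→1 → represents-trans β→1⊥γ (⟨⟩⊥-mono 1# γ→1))
                    (λ γ→ν → represents-trans β→1⊥γ (⟨⟩⊥-mono 1# γ→ν))
                    (classify ν-nonsquare γ)

    -- The plane ⟨1⟩ ⊥ ⟨1⟩ is similar to itself with any factor c = x² + y².
    similar-plane : ∀ {c} {γ : Pairing N} {δ : Pairing n} →
      γ represents (λ x y → c · δ x y) →
      ⟨ 1# ⟩⊥ ⟨ 1# ⟩⊥ γ represents (λ x y → c · (⟨ 1# ⟩⊥ ⟨ 1# ⟩⊥ δ) x y)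
    similar-plane {n = n} {c = c} {δ = δ} (f ,ᵣ f-iso) with sumOfTwoSquares 2≉0 c
    ... | s , t , s²+t²≈c = g ,ᵣ λ x y → begin
      1# · ((s · x zero + t · x (suc zero)) · (s · y zero + t · y (suc zero)))
      + (1# · ((t · x zero + - s · x (suc zero)) · (t · y zero + - s · y (suc zero))) + _)
        ≈⟨ +-cong (*-identityˡ _) (+-cong (*-identityˡ _) (f-iso _ _)) ⟩
      (s · x zero + t · x (suc zero)) · (s · y zero + t · y (suc zero))
      + ((t · x zero + - s · x (suc zero)) · (t · y zero + - s · y (suc zero))
      + c · δ (tail (tail x)) (tail (tail y)))
        ≈⟨ +-assoc _ _ _ ⟨
      (s · x zero + t · x (suc zero)) · (s · y zero + t · y (suc zero))
      + (t · x zero + - s · x (suc zero)) · (t · y zero + - s · y (suc zero))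
      + c · δ (tail (tail x)) (tail (tail y))
        ≈⟨ +-congʳ (expand s t (- s) (x zero) (x (suc zero)) (y zero) (y (suc zero))) ⟩
      (s · s + t · t) · (x zero · y zero) + (- s · - s + t · t) · (x (suc zero) · y (suc zero))
      + (s + - s) · (t · (x zero · y (suc zero) + x (suc zero) · y zero))
      + c · δ (tail (tail x)) (tail (tail y))
        ≈⟨ +-congʳ (+-cong (+-cong (*-congʳ s²+t²≈c) (*-congʳ (≈-trans (+-congʳ square-neg) s²+t²≈c)))
                     (≈-trans (*-congʳ (-‿inverseʳ s)) (zeroˡ _))) ⟩
      c · (x zero · y zero) + c · (x (suc zero) · y (suc zero)) + 0# + c · δ (tail (tail x)) (tail (tail y))
        ≈⟨ collect c (x zero · y zero) (x (suc zero) · y (suc zero)) (δ (tail (tail x)) (tail (tail y))) ⟩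
      c · (1# · (x zero · y zero) + (1# · (x (suc zero) · y (suc zero)) + δ (tail (tail x)) (tail (tail y)))) ∎
      where
      g : Vector Carrier (suc (suc n)) → Vector Carrier _
      -- The matrix with rows (s, t) and (t, -s) has orthogonal columns of norm s² + t² = c. In
      -- `expand` the letter m stands for -s, so that the cross terms carry the factor s + m.
      g x = (s · x zero + t · x (suc zero)) ∷ (t · x zero + - s · x (suc zero)) ∷ f (tail (tail x))
      square-neg : - s · - s ≈ s · s
      square-neg = ≈-trans (≈-sym (-‿distribˡ-* s (- s)))
        (≈-trans (-‿cong (≈-sym (-‿distribʳ-* s s))) (⁻¹-involutive _))
      expand : ∀ s t m x₀ x₁ y₀ y₁ →
        (s · x₀ + t · x₁) · (s · y₀ + t · y₁) + (t · x₀ + m · x₁) · (t · y₀ + m · y₁)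
        ≈ (s · s + t · t) · (x₀ · y₀) + (m · m + t · t) · (x₁ · y₁)
          + (s + m) · (t · (x₀ · y₁ + x₁ · y₀))
      expand = solve 7 (λ s t m x₀ x₁ y₀ y₁ →
        (s :* x₀ :+ t :* x₁) :* (s :* y₀ :+ t :* y₁) :+ (t :* x₀ :+ m :* x₁) :* (t :* y₀ :+ m :* y₁)
        := (s :* s :+ t :* t) :* (x₀ :* y₀) :+ (m :* m :+ t :* t) :* (x₁ :* y₁)
          :+ (s :+ m) :* (t :* (x₀ :* y₁ :+ x₁ :* y₀))) ≈-refl
      collect : ∀ c a b d → c · a + c · b + 0# + c · d ≈ c · (1# · a + (1# · b + d))
      collect = solve 4 (λ c a b d → c :* a :+ c :* b :+ con 0 :+ c :* d
        := c :* (con 1 :* a :+ (con 1 :* b :+ d))) ≈-refl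

    -- The factor c is the value on the one line left after unit vectors are removed in pairs. Each
    -- pair spans a plane similar to itself with factor c, so c can be pulled out of the whole form.
    classify-odd : ∀ h (β : NondegenerateForm (suc (h ℕ.* 2))) →
      ∃[ c ] (¬ (c ≈ 0#) × pairing β represents (λ x y → c · diagonal (replicate (suc (h ℕ.* 2)) 1#) x y))
    classify-odd zero β
      = let v , vv≉0 = anisotropic 2≉0 β
        in  pairing β v v , vv≉0 , represents-trans
              (represents-line β (λ _ → pairing β v v) v ≈-refl)
              (represents-refl λ x y →
                solve 2 (λ a b → a :* b :+ con 0 := a :* (con 1 :* b :+ con 0)) ≈-refl
                  (pairing β v v) (x zero · y zero))
    classify-odd (suc h) β
      = let γ₁ , β→1⊥γ₁ = splitUnit β (unitVector β)
            γ₂ , γ₁→1⊥γ₂ = splitUnit γ₁ (unitVector γ₁)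
            c , c≉0 , γ₂→c = classify-odd h γ₂
        in c , c≉0 , represents-trans β→1⊥γ₁ (represents-trans (⟨⟩⊥-mono 1# γ₁→1⊥γ₂) (similar-plane γ₂→c))

-- Isomorphism of looped graphs as an equivalence

≅-sym : ∀ {ℓ} {G H : LoopedGraph ℓ} → G ≅ H → H ≅ G
≅-sym {G = G} {H} (σ , adj) = mk↔ₛ′ σ.from σ.to σ.strictlyInverseʳ σ.strictlyInverseˡ , λ i j →
  let open Equivalence (adj (σ.from i) (σ.from j))
      i≡ = σ.strictlyInverseˡ i
      j≡ = σ.strictlyInverseˡ j
  in mk⇔ (λ a → from (≡.subst₂ (Adj H) (≡.sym i≡) (≡.sym j≡) a))
         (λ a → ≡.subst₂ (Adj H) i≡ j≡ (to a))
  where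
  open LoopedGraph
  module σ = Inverse σ

≅-trans : ∀ {ℓ} {G H K : LoopedGraph ℓ} → G ≅ H → H ≅ K → G ≅ K
≅-trans (σ , adj) (τ , adj′) = mk↔ₛ′ (τ.to ∘ σ.to) (σ.from ∘ τ.from)
  (λ i → ≡.trans (≡.cong τ.to (σ.strictlyInverseˡ _)) (τ.strictlyInverseˡ i))
  (λ i → ≡.trans (≡.cong σ.from (τ.strictlyInverseʳ _)) (σ.strictlyInverseʳ i)) , λ i j →
  mk⇔ (Equivalence.to (adj′ _ _) ∘ Equivalence.to (adj i j))
      (Equivalence.from (adj i j) ∘ Equivalence.from (adj′ _ _))
  where
  module σ = Inverse σ
  module τ = Inverse τ

-- The forms of symmetric matrices and the invertibility of the listed matrices

module MatrixForms {q : ℕ} {c ℓ : Level} (F : FiniteField q c ℓ) where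

  open Over F
  open import Data.Vec.Functional using ([]; _∷_)
  open FiniteField F using (commutativeRing; 1≉0; inverse)
  open FieldArithmetic F
  open QuadraticForms F
  open NondegenerateForm using (pairing)
  open Classification F using (diagonal; hyperbolic)
  open CommutativeRing commutativeRing using
    ( _+_; +-cong; +-congˡ; +-congʳ; +-identityˡ; +-identityʳ; *-identityˡ; *-identityʳ
    ; zeroˡ; zeroʳ; distribˡ; +-commutativeMonoid; commutativeSemiring
    )
  open import Algebra.Properties.CommutativeMonoid.Sum +-commutativeMonoid
    using (∑-distrib-+; sum-replicate-zero)
  open import Algebra.Solver.Ring.NaturalCoefficients.Default commutativeSemiring using
    ( solve; _:=_; _:+_; _:*_
    )
  open import Relation.Binary.Reasoning.Setoid ≈-setoid

  private
    variable
      k m n : ℕ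

  -- Bracketed as an entry of `U ᵗ ⊗ B ⊗ U`, so that adjacency in `Γ (congruence U B)` is by
  -- definition nonvanishing of this pairing on two columns.
  matrixPairing : Matrix n n → Pairing n
  matrixPairing {n} B x y = ∑[ s < n ] ((∑[ t < n ] (x t · B t s)) · y s)

  matrixPairing-symmetricBilinear : (B : SymMatrix n) → IsSymmetricBilinear (matrixPairing (matrix B))
  matrixPairing-symmetricBilinear {n} (B because B-symmetric) = record
    { linear = λ x → record
      { cong        = λ y≈z → sum-cong-≋ {n} λ s → *-congˡ (y≈z s)
      ; additive    = λ y z → ≈-trans (sum-cong-≋ {n} λ s → distribˡ _ (y s) (z s))
          (∑-distrib-+ (λ s → (∑[ t < n ] (x t · B t s)) · y s) (λ s → (∑[ t < n ] (x t · B t s)) · z s))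
      ; homogeneous = λ a y → ≈-trans
          (sum-cong-≋ {n} λ s → solve 3 (λ p a y → p :* (a :* y) := a :* (p :* y)) ≈-refl _ a (y s))
          (≈-sym (*-distribˡ-sum a (λ s → (∑[ t < n ] (x t · B t s)) · y s)))
      }
    -- Symmetry is read off the 2 by 2 congruence by the matrix whose columns are x and y.
    ; sym    = λ x y → congruence-symmetric (λ t → x t ∷ y t ∷ []) B-symmetric 1F 0F
    }

  sum-zero : ∀ n {f : Fin n → Carrier} → (∀ i → f i ≈ 0#) → sum f ≈ 0#
  sum-zero n f≈0 = ≈-trans (sum-cong-≋ {n} f≈0) (sum-replicate-zero n)

  sum-diag : ∀ (d x : Vector Carrier n) j → ∑[ t < n ] (x t · diag d t j) ≈ x j · d j
  sum-diag {suc n} d x zero    = ≈-trans (+-congˡ (sum-zero n λ t → zeroʳ _)) (+-identityʳ _)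
  sum-diag {suc n} d x (suc j) = ≈-trans (+-cong (zeroʳ _) (sum-diag (tail d) (tail x) j)) (+-identityˡ _)

  ⊗-assoc-vector : ∀ (x : Vector Carrier n) (B C : Matrix n n) j →
    ∑[ s < n ] ((∑[ t < n ] (x t · B t s)) · C s j) ≈ ∑[ t < n ] (x t · (B ⊗ C) t j)
  ⊗-assoc-vector {n} x B C j = begin
    ∑[ s < n ] ((∑[ t < n ] (x t · B t s)) · C s j)
      ≈⟨ sum-cong-≋ {n} (λ s → *-distribʳ-sum (C s j) (λ t → x t · B t s)) ⟩
    ∑[ s < n ] (∑[ t < n ] (x t · B t s · C s j))
      ≈⟨ ∑-comm (λ s t → x t · B t s · C s j) ⟩
    ∑[ t < n ] (∑[ s < n ] (x t · B t s · C s j))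
      ≈⟨ sum-cong-≋ {n} (λ t → sum-cong-≋ {n} λ s → *-assoc (x t) (B t s) (C s j)) ⟩
    ∑[ t < n ] (∑[ s < n ] (x t · (B t s · C s j)))
      ≈⟨ sum-cong-≋ {n} (λ t → *-distribˡ-sum (x t) (λ s → B t s · C s j)) ⟨
    ∑[ t < n ] (x t · (B ⊗ C) t j) ∎

  -- Pairing x with the j-th column of the inverse C returns the coordinate x j, because x B C = x
  -- as row vectors.
  invertible⇒nondegenerate : (B : Matrix n n) → Invertible B → Nondegenerate (matrixPairing B)
  invertible⇒nondegenerate {n} B (C , BC≈1 , _) x x⊥ j = begin
    x j                                              ≈⟨ *-identityʳ (x j) ⟨
    x j · 1#                                         ≈⟨ sum-diag (replicate n 1#) x j ⟨
    ∑[ t < n ] (x t · 𝐈 n t j)                       ≈⟨ sum-cong-≋ {n} (λ t → *-congˡ (BC≈1 t j)) ⟨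
    ∑[ t < n ] (x t · (B ⊗ C) t j)                   ≈⟨ ⊗-assoc-vector x B C j ⟨
    matrixPairing B x (λ s → C s j)                  ≈⟨ x⊥ _ ⟩
    0#                                               ∎

  nondegenerateForm : (B : SymMatrix n) → Invertible (matrix B) → NondegenerateForm n
  nondegenerateForm B B-invertible = record
    { pairing             = matrixPairing (matrix B)
    ; isSymmetricBilinear = matrixPairing-symmetricBilinear B
    ; nondegenerate       = invertible⇒nondegenerate (matrix B) B-invertible
    }

  diag-pairing : ∀ (d x y : Vector Carrier n) → diagonal d x y ≈ matrixPairing (diag d) x y
  diag-pairing {n} d x y = ≈-trans (weighted d x y) (sum-cong-≋ {n} λ s → *-congʳ (≈-sym (sum-diag d x s)))
    where
    weighted : ∀ {n} (d x y : Vector Carrier n) → diagonal d x y ≈ ∑[ s < n ] (x s · d s · y s)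
    weighted {zero}  d x y = ≈-refl
    weighted {suc n} d x y = +-cong
      (solve 3 (λ d x y → d :* (x :* y) := x :* d :* y) ≈-refl _ _ _) (weighted (tail d) (tail x) (tail y))

  diag-invertible : ∀ (d e : Vector Carrier n) → (∀ i → d i · e i ≈ 1#) → Invertible (diag d)
  diag-invertible {n} d e de≈1 = diag e , product d e de≈1 , product e d λ i → ≈-trans (*-comm _ _) (de≈1 i)
    where
    product : ∀ d e → (∀ i → d i · e i ≈ 1#) → diag d ⊗ diag e ≈ᴹ 𝐈 n
    product d e de≈1 i j = ≈-trans (sum-diag e (diag d i) j) (entry j)
      where
      entry : ∀ j → diag d i j · e j ≈ 𝐈 n i j
      entry j with i ≟ j
      ... | yes refl = de≈1 i
      ... | no  _    = zeroˡ _

  𝐈-invertible : ∀ n → Invertible (𝐈 n)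
  𝐈-invertible n = diag-invertible (replicate n 1#) (replicate n 1#) λ _ → *-identityʳ 1#

  diagI-ν-invertible : ∀ k .{{_ : ℕ.NonZero k}} ν → ¬ (ν ≈ 0#) → Invertible (matrix (diagI-ν k ν))
  diagI-ν-invertible (suc n) ν ν≉0 with inverse ν ν≉0
  ... | ν⁻¹ , νν⁻¹≈1 = diag-invertible _ (insertAt (replicate n 1#) (fromℕ n) ν⁻¹) (product n)
    where
    product : ∀ n i → insertAt (replicate n 1#) (fromℕ n) ν i · insertAt (replicate n 1#) (fromℕ n) ν⁻¹ i ≈ 1#
    product zero    zero    = νν⁻¹≈1
    product (suc n) zero    = *-identityʳ 1#
    product (suc n) (suc i) = product n i

  hyperbolicMatrix : ∀ h → Matrix (h ℕ.* 2) (h ℕ.* 2)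
  hyperbolicMatrix h = blockDiag (replicate h H)

  private
    -- Multiplying a row vector by the block matrix exchanges the two coordinates of every block.
    -- Both the pairing and, for x a row of the matrix, the square of the matrix are computed
    -- through it.
    swapH : ∀ h → Vector Carrier (h ℕ.* 2) → Vector Carrier (h ℕ.* 2)
    swapH h x s = ∑[ t < h ℕ.* 2 ] (x t · hyperbolicMatrix h t s)

    row : ∀ h → Fin (suc h ℕ.* 2) → Vector Carrier (suc h ℕ.* 2)
    row h = hyperbolicMatrix (suc h)

    swapH-0 : ∀ h x → swapH (suc h) x 0F ≈ x 1F
    swapH-0 h x = ≈-trans
      (+-cong (zeroʳ _) (+-cong (*-identityʳ _) (sum-zero (h ℕ.* 2) λ t → zeroʳ _)))
      (≈-trans (+-identityˡ _) (+-identityʳ _))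

    swapH-1 : ∀ h x → swapH (suc h) x 1F ≈ x 0F
    swapH-1 h x = ≈-trans
      (+-cong (*-identityʳ _) (+-cong (zeroʳ _) (sum-zero (h ℕ.* 2) λ t → zeroʳ _)))
      (≈-trans (+-congˡ (+-identityˡ _)) (+-identityʳ _))

    swapH-2+ : ∀ h x s → swapH (suc h) x (suc (suc s)) ≈ swapH h (tail (tail x)) s
    swapH-2+ h x s = ≈-trans (+-cong (zeroʳ _) (≈-trans (+-congʳ (zeroʳ _)) (+-identityˡ _))) (+-identityˡ _)

    swapH-𝟎 : ∀ h s → swapH h 𝟎 s ≈ 0#
    swapH-𝟎 h s = sum-zero (h ℕ.* 2) λ t → zeroˡ (hyperbolicMatrix h t s)

  hyperbolic-pairing : ∀ h x y → hyperbolic h x y ≈ matrixPairing (hyperbolicMatrix h) x y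
  hyperbolic-pairing zero    x y = ≈-refl
  hyperbolic-pairing (suc h) x y = begin
    x 0F · y 1F + x 1F · y 0F + hyperbolic h (tail (tail x)) (tail (tail y))
      ≈⟨ solve 3 (λ a b c → a :+ b :+ c := b :+ (a :+ c)) ≈-refl _ _ _ ⟩
    x 1F · y 0F + (x 0F · y 1F + hyperbolic h (tail (tail x)) (tail (tail y)))
      ≈⟨ +-cong (*-congʳ (swapH-0 h x)) (+-cong (*-congʳ (swapH-1 h x))
           (≈-trans (sum-cong-≋ {h ℕ.* 2} λ s → *-congʳ (swapH-2+ h x s))
             (≈-sym (hyperbolic-pairing h (tail (tail x)) (tail (tail y)))))) ⟨
    matrixPairing (hyperbolicMatrix (suc h)) x y ∎

  hyperbolicMatrix-involutive : ∀ h → hyperbolicMatrix h ⊗ hyperbolicMatrix h ≈ᴹ 𝐈 (h ℕ.* 2)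
  hyperbolicMatrix-involutive (suc h) 0F            0F            = swapH-0 h (row h 0F)
  hyperbolicMatrix-involutive (suc h) 1F            0F            = swapH-0 h (row h 1F)
  hyperbolicMatrix-involutive (suc h) (suc (suc i)) 0F            = swapH-0 h (row h (suc (suc i)))
  hyperbolicMatrix-involutive (suc h) 0F            1F            = swapH-1 h (row h 0F)
  hyperbolicMatrix-involutive (suc h) 1F            1F            = swapH-1 h (row h 1F)
  hyperbolicMatrix-involutive (suc h) (suc (suc i)) 1F            = swapH-1 h (row h (suc (suc i)))
  hyperbolicMatrix-involutive (suc h) 0F            (suc (suc j)) = ≈-trans (swapH-2+ h (row h 0F) j) (swapH-𝟎 h j)
  hyperbolicMatrix-involutive (suc h) 1F            (suc (suc j)) = ≈-trans (swapH-2+ h (row h 1F) j) (swapH-𝟎 h j)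
  hyperbolicMatrix-involutive (suc h) (suc (suc i)) (suc (suc j)) = ≈-trans
    (swapH-2+ h (row h (suc (suc i))) j) (hyperbolicMatrix-involutive h i j)

  hyperbolicMatrix-invertible : ∀ h → Invertible (hyperbolicMatrix h)
  hyperbolicMatrix-invertible h =
    hyperbolicMatrix h , hyperbolicMatrix-involutive h , hyperbolicMatrix-involutive h

  diagH-invertible : (2∣k : 2 ∣ k) → Invertible (matrix (diagH 2∣k))
  diagH-invertible (divides h refl) = hyperbolicMatrix-invertible h

  infix 4 _representsMultipleOf_

  -- The factor a is what similarity adds to isometry; being nonzero, it does not affect which
  -- pairings vanish, and the graph records only that.
  _representsMultipleOf_ : SymMatrix n → SymMatrix n → Set (c ⊔ ℓ)
  B representsMultipleOf B′ = ∃[ a ] (¬ (a ≈ 0#) ×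
    (matrixPairing (matrix B) represents (λ x y → a · matrixPairing (matrix B′) x y)))

  represents⇒representsMultipleOf : (B B′ : SymMatrix n) {γ : Pairing n} →
    (∀ x y → γ x y ≈ matrixPairing (matrix B′) x y) → matrixPairing (matrix B) represents γ →
    B representsMultipleOf B′
  represents⇒representsMultipleOf B B′ γ≈B′ B→γ = 1# , 1≉0 , represents-trans B→γ
    (represents-refl λ x y → ≈-trans (γ≈B′ x y) (≈-sym (*-identityˡ _)))

-- From similar forms to isomorphic graphs

module RepresentativeGraphs {q : ℕ} {c ℓ : Level} (F : FiniteField q c ℓ) where

  open Over F
  open import Data.Vec.Functional using (_∷_)
  open FiniteField F using (commutativeRing; 1≉0; inverse)
  open FieldArithmetic F
  open QuadraticForms F
  open MatrixForms F
  open CommutativeRing commutativeRing using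
    ( _+_; -_; +-congˡ; +-congʳ; *-identityˡ; zeroˡ; zeroʳ; -‿inverseʳ; ring; +-group
    )
  open import Algebra.Properties.Group +-group using (x∙y⁻¹≈ε⇒x≈y)
  open import Algebra.Properties.Ring ring using (-‿distribˡ-*)
  open import Relation.Binary.Reasoning.Setoid ≈-setoid

  private
    variable
      k m m₀ : ℕ

  ∼-refl-≈ : ∀ {x y : Vector Carrier k} → x ≈ⱽ y → x ∼ y
  ∼-refl-≈ x≈y = 1# , 1≉0 , λ i → ≈-trans (≈-sym (x≈y i)) (≈-sym (*-identityˡ _))

  ∼-sym : ∀ {x y : Vector Carrier k} → x ∼ y → y ∼ x
  ∼-sym {x = x} {y} (a , a≉0 , y≈ax) with inverse a a≉0
  ... | b , ab≈1 = b , inverse-nonzero ab≈1 , λ i → ·-cancelˡ a≉0 (begin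
    a · x i          ≈⟨ y≈ax i ⟨
    y i              ≈⟨ *-identityˡ _ ⟨
    1# · y i         ≈⟨ *-congʳ ab≈1 ⟨
    a · b · y i      ≈⟨ *-assoc a b _ ⟩
    a · (b · y i)    ∎)

  ∼-trans : ∀ {x y z : Vector Carrier k} → x ∼ y → y ∼ z → x ∼ z
  ∼-trans (a , a≉0 , y≈ax) (b , b≉0 , z≈by) = b · a , ·-nonzero b≉0 a≉0 , λ i →
    ≈-trans (z≈by i) (≈-trans (*-congˡ (y≈ax i)) (≈-sym (*-assoc b a _)))

  _∼?_ : (x y : Vector Carrier k) → Dec (x ∼ y)
  x ∼? y = map′
    (λ (i , a≉0 , y≈ax) → element i , a≉0 , y≈ax)
    (λ (a , a≉0 , y≈ax) → index a , (λ eq → a≉0 (≈-trans (≈-sym (element-index a)) eq)) ,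
      λ i → ≈-trans (y≈ax i) (*-congʳ (≈-sym (element-index a))))
    (any? λ i → ¬? (element i ≈? 0#) ×-dec all? λ j → y j ≈? element i · x j)

  scalar-nonzero : ∀ {x y : Vector Carrier k} {a} → NonzeroVector y → y ≈ⱽ a • x → ¬ (a ≈ 0#)
  scalar-nonzero y≉0 y≈ax a≈0 = y≉0 λ i → ≈-trans (y≈ax i) (≈-trans (*-congʳ a≈0) (zeroˡ _))

  -- A vector on a line missed by U could be prepended as a further column without creating
  -- proportional columns. Maximality would then make it equal to a column of U.
  maximal⇒representatives : {U : Matrix k m} → IsMaximalNonproportional U → IsRepresentatives U
  maximal⇒representatives {k} {m} {U} U-maximal = record
    { nonzero    = nonzero
    ; distinct   = distinct
    ; exhaustive = exhaustive
    }
    where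
    open IsMaximalNonproportional U-maximal
    open NonzeroNonproportional nonzeroNonproportional

    distinct : ∀ i j → column U i ∼ column U j → i ≡ j
    distinct i j (a , _ , Uⱼ≈aUᵢ) with j ≟ i
    ... | yes j≡i = ≡.sym j≡i
    ... | no  j≢i = contradiction (a , Uⱼ≈aUᵢ) (nonproportional j i j≢i)

    exhaustive : ∀ v → NonzeroVector v → ∃[ j ] (column U j ∼ v)
    exhaustive v v≉0 with any? (λ j → column U j ∼? v)
    ... | yes found = found
    ... | no  none  = contradiction
      (let j , v≈Uⱼ = maximal V V-nonproportional (λ i → suc i , λ _ → ≈-refl) zero
       in  j , ∼-sym (∼-refl-≈ v≈Uⱼ)) none
      where
      V : Matrix k (suc m)
      V t = v t ∷ U t
      V-nonproportional : NonzeroNonproportional V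
      V-nonproportional = record
        { nonzero         = λ { zero → v≉0 ; (suc j) → nonzero j }
        ; nonproportional = λ where
            zero    zero    0≢0 _            → 0≢0 refl
            zero    (suc j) _   (a , v≈aUⱼ)  → none (j , a , scalar-nonzero v≉0 v≈aUⱼ , v≈aUⱼ)
            (suc i) zero    _   (a , Uᵢ≈av)  →
              none (i , ∼-sym (a , scalar-nonzero (nonzero i) Uᵢ≈av , Uᵢ≈av))
            (suc i) (suc j) i≢j proportional → nonproportional i j (i≢j ∘ ≡.cong suc) proportional
        }

  -- Sending each column of U to the column of X on the same line is injective. Used in both
  -- directions, it gives equal numbers of vertices.
  representatives-≤ : {X : Matrix k m₀} {U : Matrix k m} →
                      IsRepresentatives X → IsRepresentatives U → m ℕ.≤ m₀
  representatives-≤ {X = X} {U} X-reps U-reps = injective⇒≤ {f = proj₁ ∘ rep} λ {i} {j} eq →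
    U.distinct i j (∼-trans (∼-sym (proj₂ (rep i)))
      (≡.subst (λ t → column X t ∼ column U j) (≡.sym eq) (proj₂ (rep j))))
    where
    module X = IsRepresentatives X-reps
    module U = IsRepresentatives U-reps
    rep : ∀ j → ∃[ t ] (column X t ∼ column U j)
    rep j = X.exhaustive (column U j) (U.nonzero j)

  injective⇒↔ : ∀ {m n} → m ≡ n → (f : Fin m → Fin n) → Injective _≡_ _≡_ f →
                Σ[ σ ∈ Fin m ↔ Fin n ] (∀ i → Inverse.to σ i ≡ f i)
  injective⇒↔ refl f f-injective =
    mk↔ₛ′ f (proj₁ ∘ surjective) (proj₂ ∘ surjective) (λ i → f-injective (proj₂ (surjective (f i)))) ,
    λ _ → refl
    where surjective = injective⇒surjective f-injective

  module _ {X : Matrix k m₀} {U : Matrix k m}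
           (X-reps : IsRepresentatives X) (U-reps : IsRepresentatives U)
           (B B′ : SymMatrix k) (B′-nondegenerate : Nondegenerate (matrixPairing (matrix B′)))
           {a : Carrier} (a≉0 : ¬ (a ≈ 0#))
           (B→aB′ : matrixPairing (matrix B) represents (λ x y → a · matrixPairing (matrix B′) x y)) where

    private
      module X = IsRepresentatives X-reps
      module U = IsRepresentatives U-reps
      β β′ : Pairing k
      β  = matrixPairing (matrix B)
      β′ = matrixPairing (matrix B′)
      module β = IsSymmetricBilinear (matrixPairing-symmetricBilinear B)
      module β′ = IsSymmetricBilinear (matrixPairing-symmetricBilinear B′)
      open _represents_ B→aB′ renaming (embed to f)

      f-nonzero : ∀ {u} → NonzeroVector u → NonzeroVector (f u)
      f-nonzero {u} u≉0 fu≈0 = u≉0 (B′-nondegenerate u λ z → ·-noZeroDivisor a≉0 (begin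
        a · β′ u z       ≈⟨ isometric u z ⟨
        β (f u) (f z)    ≈⟨ β.sym _ _ ⟩
        β (f z) (f u)    ≈⟨ β.vanishes-at-zero fu≈0 ⟩
        0#               ∎))

      -- Linearity of f is not at hand, so proportionality is recovered through the pairing: f v = s
      -- f u yields β′(v, z) = s β′(u, z) for every z, which puts v - s u in the radical of β′.
      f-reflects-∼ : ∀ {u v} → f u ∼ f v → u ∼ v
      f-reflects-∼ {u} {v} (s , s≉0 , fv≈sfu) = s , s≉0 , λ i → x∙y⁻¹≈ε⇒x≈y (v i) (s · u i) (begin
        v i + - (s · u i)    ≈⟨ +-congˡ (-‿distribˡ-* s (u i)) ⟩
        v i + - s · u i      ≈⟨ B′-nondegenerate (v ⊹ (- s) • u) perpendicular i ⟩
        0#                   ∎)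
        where
        scaled : ∀ z → β′ v z ≈ s · β′ u z
        scaled z = ·-cancelˡ a≉0 (begin
          a · β′ v z            ≈⟨ isometric v z ⟨
          β (f v) (f z)         ≈⟨ β.congˡ fv≈sfu ⟩
          β (s • f u) (f z)     ≈⟨ β.homogeneousˡ s (f u) (f z) ⟩
          s · β (f u) (f z)     ≈⟨ *-congˡ (isometric u z) ⟩
          s · (a · β′ u z)      ≈⟨ *-assoc s a _ ⟨
          s · a · β′ u z        ≈⟨ *-congʳ (*-comm s a) ⟩
          a · s · β′ u z        ≈⟨ *-assoc a s _ ⟩
          a · (s · β′ u z)      ∎)
        perpendicular : ∀ z → β′ (v ⊹ (- s) • u) z ≈ 0#
        perpendicular z = begin
          β′ (v ⊹ (- s) • u) z           ≈⟨ β′.additiveˡ v _ z ⟩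
          β′ v z + β′ ((- s) • u) z      ≈⟨ +-congˡ (β′.homogeneousˡ (- s) u z) ⟩
          β′ v z + - s · β′ u z          ≈⟨ +-congˡ (-‿distribˡ-* s _) ⟨
          β′ v z + - (s · β′ u z)        ≈⟨ +-congʳ (scaled z) ⟩
          s · β′ u z + - (s · β′ u z)    ≈⟨ -‿inverseʳ _ ⟩
          0#                             ∎

      rep : ∀ j → ∃[ t ] (column X t ∼ f (column U j))
      rep j = X.exhaustive (f (column U j)) (f-nonzero (U.nonzero j))

      rep-injective : Injective _≡_ _≡_ (proj₁ ∘ rep)
      rep-injective {i} {j} eq = U.distinct i j (f-reflects-∼ (∼-trans (∼-sym (proj₂ (rep i)))
        (≡.subst (λ t → column X t ∼ f (column U j)) (≡.sym eq) (proj₂ (rep j)))))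

      rescaled : ∀ i j → ∃[ s ] (¬ (s ≈ 0#) × a · β′ (column U i) (column U j)
                   ≈ s · β (column X (proj₁ (rep i))) (column X (proj₁ (rep j))))
      rescaled i j = s · t , ·-nonzero s≉0 t≉0 , (begin
        a · β′ (column U i) (column U j)          ≈⟨ isometric _ _ ⟨
        β (f (column U i)) (f (column U j))       ≈⟨ β.congˡ fu≈sx ⟩
        β (s • column X x) (f (column U j))       ≈⟨ β.homogeneousˡ s _ _ ⟩
        s · β (column X x) (f (column U j))       ≈⟨ *-congˡ (β.cong fv≈ty) ⟩
        s · β (column X x) (t • column X y)       ≈⟨ *-congˡ (β.homogeneous t _) ⟩
        s · (t · β (column X x) (column X y))     ≈⟨ *-assoc s t _ ⟨
        s · t · β (column X x) (column X y)       ∎)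
        where
        x : Fin m₀
        x = proj₁ (rep i)
        y : Fin m₀
        y = proj₁ (rep j)
        open Σ (proj₂ (rep i)) renaming (proj₁ to s; proj₂ to s-scales)
        open Σ (proj₂ (rep j)) renaming (proj₁ to t; proj₂ to t-scales)
        open Σ s-scales renaming (proj₁ to s≉0; proj₂ to fu≈sx)
        open Σ t-scales renaming (proj₁ to t≉0; proj₂ to fv≈ty)

      adjacent : ∀ i j → (¬ (β′ (column U i) (column U j) ≈ 0#)) ⇔
                         (¬ (β (column X (proj₁ (rep i))) (column X (proj₁ (rep j))) ≈ 0#))
      adjacent i j = let s , s≉0 , eq = rescaled i j in mk⇔
        (λ β′≉0 β≈0 → β′≉0 (·-noZeroDivisor a≉0 (≈-trans eq (≈-trans (*-congˡ β≈0) (zeroʳ s)))))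
        (λ β≉0 β′≈0 → β≉0 (·-noZeroDivisor s≉0 (≈-trans (≈-sym eq) (≈-trans (*-congˡ β′≈0) (zeroʳ a)))))

    -- The vertex of Uⱼ goes to the representative in X of the line through f Uⱼ. Passing to
    -- representatives changes each pairing by a nonzero factor, so adjacency is preserved in both
    -- directions.
    congruence-≅ : Γ (congruence U B′) ≅ Γ (congruence X B)
    congruence-≅ =
      let m≡m₀ = ℕ.≤-antisym (representatives-≤ X-reps U-reps) (representatives-≤ U-reps X-reps)
          σ , σ≡rep = injective⇒↔ m≡m₀ (proj₁ ∘ rep) rep-injective
      in  σ , λ i j → ≡.subst₂
            (λ s t → (¬ (β′ (column U i) (column U j) ≈ 0#)) ⇔ (¬ (β (column X s) (column X t) ≈ 0#)))
            (≡.sym (σ≡rep i)) (≡.sym (σ≡rep j)) (adjacent i j)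

  module _ {X : Matrix k m₀} {U : Matrix k m}
           (X-reps : IsRepresentatives X) (U-reps : IsRepresentatives U) where

    -- This reduces each case of the theorem to algebra: the listed matrices are invertible, and
    -- every invertible symmetric matrix represents a nonzero multiple of a listed one.
    𝔤≐GraphsFrom : (𝓑 : List (SymMatrix k)) →
      (∀ {B} → B ∈ 𝓑 → Invertible (matrix B)) →
      (∀ B → Invertible (matrix B) → ∃[ B′ ] (B′ ∈ 𝓑 × B representsMultipleOf B′)) →
      𝔤 X ≐ GraphsFrom U 𝓑
    𝔤≐GraphsFrom 𝓑 𝓑-invertible 𝓑-exhaustive = (λ {G} → to {G}) , (λ {G} → from {G})
      where
      to : ∀ {G} → 𝔤 X G → GraphsFrom U 𝓑 G
      to {G} (B , B-invertible , G≅) with 𝓑-exhaustive B B-invertible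
      ... | B′ , B′∈𝓑 , a , a≉0 , B→aB′ = B′ , B′∈𝓑 ,
        ≅-trans {G = G} {Γ (congruence X B)} {Γ (congruence U B′)} G≅
          (≅-sym {G = Γ (congruence U B′)} {Γ (congruence X B)}
            (congruence-≅ X-reps U-reps B B′ (invertible⇒nondegenerate _ (𝓑-invertible B′∈𝓑)) a≉0 B→aB′))
      from : ∀ {G} → GraphsFrom U 𝓑 G → 𝔤 X G
      from {G} (B , B∈𝓑 , G≅) = B , 𝓑-invertible B∈𝓑 ,
        ≅-trans {G = G} {Γ (congruence U B)} {Γ (congruence X B)} G≅
          -- With the same matrix on both sides and factor 1, `congruence-≅` says that the graph
          -- does not depend on the chosen representatives.
          (congruence-≅ X-reps U-reps B B (invertible⇒nondegenerate _ (𝓑-invertible B∈𝓑)) 1≉0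
            (represents-refl λ x y → ≈-sym (*-identityˡ _)))

-- Classification of invertible symmetric matrices

even-or-odd : ∀ k → 2 ∣ k ⊎ ∃[ h ] k ≡ suc (h ℕ.* 2)
even-or-odd zero    = inj₁ (divides 0 refl)
even-or-odd (suc k) with even-or-odd k
... | inj₁ (divides h k≡2h) = inj₂ (h , ≡.cong suc k≡2h)
... | inj₂ (h , k≡1+2h)     = inj₁ (divides (suc h) (≡.cong suc k≡1+2h))

module MatrixClassification {q : ℕ} {c ℓ : Level} (F : FiniteField q c ℓ) where

  open Over F
  open FiniteField F using (commutativeRing)
  open FieldArithmetic F
  open QuadraticForms F
  open Classification F
  open MatrixForms F
  open CommutativeRing commutativeRing using (_+_; zeroˡ)

  private
    variable
      k : ℕ

  -- In characteristic 2 the hyperbolic alternative would make k even, and the factor is 1.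
  -- Otherwise the factor is the one produced by `CharNot2.classify-odd`.
  representsMultipleOf-𝐈 : ¬ (2 ∣ k) → (B : SymMatrix k) → Invertible (matrix B) →
                           B representsMultipleOf identity k
  representsMultipleOf-𝐈 {k} 2∤k B B-invertible = [ char2 , charNot2 ]′ (toSum (1# + 1# ≈? 0#))
    where
    char2 : 1# + 1# ≈ 0# → B representsMultipleOf identity k
    char2 2≈0 =
      [ represents⇒representsMultipleOf B (identity k) (diag-pairing (replicate k 1#))
      , (λ (h , k≡2h , _) → contradiction (divides h k≡2h) 2∤k)
      ]′ (Char2.classify 2≈0 (nondegenerateForm B B-invertible))
    charNot2 : ¬ (1# + 1# ≈ 0#) → B representsMultipleOf identity k
    charNot2 2≉0 = [ (λ 2∣k → contradiction 2∣k 2∤k) , (λ (h , k≡1+2h) → odd h k≡1+2h) ]′ (even-or-odd k)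
      where
      odd : ∀ h → k ≡ suc (h ℕ.* 2) → B representsMultipleOf identity k
      odd h refl =
        let a , a≉0 , B→a = CharNot2.classify-odd 2≉0 h (nondegenerateForm B B-invertible)
        in  a , a≉0 , represents-trans B→a
              (represents-refl λ x y → *-congˡ (diag-pairing (replicate k 1#) x y))

  representsMultipleOf-𝐈-or-diagH : (2∣k : 2 ∣ k) → 1# + 1# ≈ 0# →
    (B : SymMatrix k) → Invertible (matrix B) →
    B representsMultipleOf identity k ⊎ B representsMultipleOf diagH 2∣k
  representsMultipleOf-𝐈-or-diagH (divides h refl) 2≈0 B B-invertible = Sum.map
    (represents⇒representsMultipleOf B (identity _) (diag-pairing (replicate (h ℕ.* 2) 1#)))
    (λ (h′ , 2h≡2h′ , B→H) → hyperbolicCase h′ (ℕ.*-cancelʳ-≡ h h′ 2 2h≡2h′) B→H)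
    (Char2.classify 2≈0 (nondegenerateForm B B-invertible))
    where
    hyperbolicCase : ∀ h′ → h ≡ h′ → matrixPairing (matrix B) represents hyperbolic h′ →
                     B representsMultipleOf diagH (divides h refl)
    hyperbolicCase _ refl = represents⇒representsMultipleOf B (diagH (divides h refl)) (hyperbolic-pairing h)

  representsMultipleOf-𝐈-or-diagI-ν : ∀ k .{{_ : NonZero k}} → ¬ (1# + 1# ≈ 0#) →
    ∀ {ν} → ¬ IsSquare ν → (B : SymMatrix k) → Invertible (matrix B) →
    B representsMultipleOf identity k ⊎ B representsMultipleOf diagI-ν k ν
  representsMultipleOf-𝐈-or-diagI-ν (suc n) 2≉0 {ν} ν-nonsquare B B-invertible = Sum.map
    (represents⇒representsMultipleOf B (identity (suc n)) (diag-pairing (replicate (suc n) 1#)))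
    (represents⇒representsMultipleOf B (diagI-ν (suc n) ν)
      (diag-pairing (insertAt (replicate n 1#) (fromℕ n) ν)))
    (CharNot2.classify 2≉0 ν-nonsquare (nondegenerateForm B B-invertible))

-- The three cases of the theorem

open import Data.List.Base using (_∷_; [])

mainTheorem2 : ∀ {c ℓ : Level} (q : ℕ) → IsPrimePower q → (F : FiniteField q c ℓ) →
    let open Over F in
    (k : ℕ) .{{_ : NonZero k}} →
    {m₀ : ℕ} (X : Matrix k m₀) → IsRepresentatives X →
    {m : ℕ} (U : Matrix k m) → IsMaximalNonproportional U →
    (¬ (2 ∣ k) →
    𝔤 X ≐ GraphsFrom U (identity k ∷ []))
    × ((2∣k : 2 ∣ k) → 2 ∣ q →
    𝔤 X ≐ GraphsFrom U (identity k ∷ diagH 2∣k ∷ []))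
    × (2 ∣ k → ¬ (2 ∣ q) → ∀ ν → ¬ IsSquare ν →
    𝔤 X ≐ GraphsFrom U (identity k ∷ diagI-ν k ν ∷ []))
mainTheorem2 q q-primePower F k X X-reps U U-maximal =
  (λ 2∤k → 𝔤≐GraphsFrom X-reps U-reps (identity k ∷ [])
    (λ { (here refl) → 𝐈-invertible k ; (there ()) })
    (λ B B-invertible → identity k , here refl , representsMultipleOf-𝐈 2∤k B B-invertible)) ,
  (λ 2∣k 2∣q → 𝔤≐GraphsFrom X-reps U-reps (identity k ∷ diagH 2∣k ∷ [])
    (λ { (here refl) → 𝐈-invertible k
       ; (there (here refl)) → diagH-invertible 2∣k
       ; (there (there ())) })
    (λ B B-invertible → oneOf B
      (representsMultipleOf-𝐈-or-diagH 2∣k (2∣q⇒char2 q-primePower 2∣q) B B-invertible))) ,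
  (λ _ _ ν ν-nonsquare → 𝔤≐GraphsFrom X-reps U-reps (identity k ∷ diagI-ν k ν ∷ [])
    (λ { (here refl) → 𝐈-invertible k
       ; (there (here refl)) → diagI-ν-invertible k ν λ ν≈0 →
           ν-nonsquare (0# , ≈-trans (zeroˡ 0#) (≈-sym ν≈0))
       ; (there (there ())) })
    (λ B B-invertible → oneOf B (representsMultipleOf-𝐈-or-diagI-ν k
      -- A nonsquare excludes characteristic 2, where every element is a square.
      (λ 2≈0 → ν-nonsquare (char2⇒isSquare 2≈0 ν)) ν-nonsquare B B-invertible)))
  where
  open Over F
  open CommutativeRing (FiniteField.commutativeRing F) using (zeroˡ)
  open FieldArithmetic F using (2∣q⇒char2; char2⇒isSquare)
  open MatrixForms F
  open RepresentativeGraphs F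
  open MatrixClassification F
  U-reps = maximal⇒representatives U-maximal
  oneOf : ∀ B {D E : SymMatrix k} → B representsMultipleOf D ⊎ B representsMultipleOf E →
          ∃[ B′ ] (B′ ∈ (D ∷ E ∷ []) × B representsMultipleOf B′)
  oneOf B (inj₁ B→D) = _ , here refl , B→D
  oneOf B (inj₂ B→E) = _ , there (here refl) , B→E
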